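{- Let $f: \mathbb{R}^2 \to \mathbb{R}$ be a function. Then the following are equivalent. (a) The function $f$ is transintegral polyhedral. (b) The restriction of $f$ to each horizontal line and each vertical line is transintegral polyhedral. (c) The restriction of $f$ to each translate of the set \[ L = \{(x,y) \in \mathbb{R}^2: x = 0,\ y \leq 0 \} \cup \{(x,y) \in \mathbb{R}^2: x \leq 0,\ y = 0\} \cup \{(x,y) \in \mathbb{R}^2: x = y \geq 0\} \] is transintegral polyhedral.
   Context: An affine functional $\lambda(x,y)=a_1x+a_2y+b$ on $\mathbb{R}^2$ is transintegral if $a_1,a_2\in\mathbb{Z}$ and $b\in\mathbb{R}$. For any subset $T\subseteq\mathbb{R}^2$, a function $g:T\to\mathbb{R}$ is transintegral polyhedral if $g(x)=\max\{\lambda_1(x),\dots,\lambda_m(x)\}$ for all $x\in T$, for some finite list of transintegral affine functionals $\lambda_1,\dots,\lambda_m$ on $\mathbb{R}^2$. -}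

module Defs where

open import Algebra.Bundles using (CommutativeRing)
open import Algebra.Structures using (IsCommutativeRing)
import Algebra.Definitions.RawMonoid as RawMonoidMult
open import Data.Integer.Base using (ℤ; +_; -[1+_])
open import Data.List.Base using (map)
open import Data.List.NonEmpty.Base using (List⁺; _∷_)
open import Data.List.NonEmpty.Relation.Unary.All using (All)
import Data.List.Extrema as Extrema
open import Data.Nat.Base using (suc)
open import Data.Product.Base using (Σ; _×_; _,_; ∃)
open import Data.Product.Relation.Binary.Pointwise.NonDependent using (_×ₛ_)
open import Data.Sum.Base using (_⊎_)
open import Function.Bundles using (Func)
open import Level using (0ℓ) renaming (suc to lsuc)
open import Relation.Binary.Bundles using (Setoid; TotalOrder)
open import Relation.Binary.Core using (Rel)
open import Relation.Binary.Structures using (IsTotalOrder)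
open import Relation.Nullary.Negation.Core using (¬_)
open import Relation.Unary using (Pred; Satisfiable)

-- The library has no real numbers.  ℝ is taken to be any Dedekind-complete
-- ordered field, which determines it up to isomorphism in classical logic.
-- Without quotient types, equality of reals is an equivalence relation.
record CompleteOrderedField : Set (lsuc 0ℓ) where
  infix  8 -_
  infixl 7 _*_
  infixl 6 _+_
  infix  4 _≈_ _≤_
  field
    Carrier           : Set
    _≈_               : Rel Carrier 0ℓ
    _≤_               : Rel Carrier 0ℓ
    _+_ _*_           : Carrier → Carrier → Carrier
    -_                : Carrier → Carrier
    0# 1#             : Carrier
    isCommutativeRing : IsCommutativeRing _≈_ _+_ _*_ -_ 0# 1#
    isTotalOrder      : IsTotalOrder _≈_ _≤_
    0≉1               : ¬ (0# ≈ 1#)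
    inverse           : ∀ x → ¬ (x ≈ 0#) → ∃ λ y → x * y ≈ 1#
    +-monoˡ-≤         : ∀ z {x y} → x ≤ y → x + z ≤ y + z
    *-nonNeg          : ∀ {x y} → 0# ≤ x → 0# ≤ y → 0# ≤ x * y

  _IsUpperBoundOf_ : Carrier → Pred Carrier 0ℓ → Set
  u IsUpperBoundOf S = ∀ x → S x → x ≤ u

  field
    supremum : (S : Pred Carrier 0ℓ) → Satisfiable S → ∃ (_IsUpperBoundOf S) →
               ∃ λ s → s IsUpperBoundOf S × (∀ u → u IsUpperBoundOf S → s ≤ u)

  commutativeRing : CommutativeRing 0ℓ 0ℓ
  commutativeRing = record { isCommutativeRing = isCommutativeRing }

  totalOrder : TotalOrder 0ℓ 0ℓ 0ℓ
  totalOrder = record { isTotalOrder = isTotalOrder }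

  setoid : Setoid 0ℓ 0ℓ
  setoid = CommutativeRing.setoid commutativeRing

  open RawMonoidMult (CommutativeRing.+-rawMonoid commutativeRing)
    using () renaming (_×_ to _·_)

  fromℤ : ℤ → Carrier
  fromℤ (+ n)    = n · 1#
  fromℤ -[1+ n ] = - (suc n · 1#)

  IsInteger : Pred Carrier 0ℓ
  IsInteger a = ∃ λ n → a ≈ fromℤ n

module Plane (R : CompleteOrderedField) where
  open CompleteOrderedField R renaming (Carrier to ℝ)
  open Extrema totalOrder using (max)

  ℝ² : Set
  ℝ² = ℝ × ℝ

  -- Functions ℝ² → ℝ respecting equality of reals.
  Function² : Set
  Function² = Func (setoid ×ₛ setoid) setoid

  record AffineFunctional : Set where
    field
      a₁ a₂ b : ℝ

    eval : ℝ² → ℝ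
    eval (x , y) = a₁ * x + a₂ * y + b

  open AffineFunctional using (eval)

  Transintegral : Pred AffineFunctional 0ℓ
  Transintegral λ′ = IsInteger a₁ × IsInteger a₂
    where open AffineFunctional λ′

  maxEval : List⁺ AffineFunctional → ℝ² → ℝ
  maxEval (l ∷ ls) p = max (eval l p) (map (λ l′ → eval l′ p) ls)

  TransintegralPolyhedral : (T : Pred ℝ² 0ℓ) → (Σ ℝ² T → ℝ) → Set
  TransintegralPolyhedral T g =
    ∃ λ ls → All Transintegral ls ×
             (∀ p (p∈T : T p) → g (p , p∈T) ≈ maxEval ls p)

  restrict : (T : Pred ℝ² 0ℓ) → Function² → Σ ℝ² T → ℝ
  restrict T f (p , _) = Func.to f p

  horizontalLine verticalLine : ℝ → Pred ℝ² 0ℓ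
  horizontalLine c (x , y) = y ≈ c
  verticalLine   c (x , y) = x ≈ c

  L : Pred ℝ² 0ℓ
  L (x , y) = (x ≈ 0# × y ≤ 0#) ⊎ (x ≤ 0# × y ≈ 0#) ⊎ (x ≈ y × 0# ≤ y)

  translate : ℝ² → Pred ℝ² 0ℓ → Pred ℝ² 0ℓ
  translate (u , v) T (x , y) = T (x + - u , y + - v)

module Submission where

-- f has integral slopes on rows and columns, so a C² function touching f from
-- above at a point excludes kinks there, which forces f to be affine near that
-- point.  Hence, as in the theory of viscosity solutions, a touching function
-- which is concave along some line leads to a contradiction, and f is convex
-- along every line.  Every point of the graph of f then has a supporting plane
-- with integral slopes.  These slopes are bounded, because f is polyhedral on
-- the two axes (or on a tripod), so finitely many of the planes suffice.

open import Defs
open import Axiom.ExcludedMiddle using (ExcludedMiddle)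
open import Algebra.Bundles using (CommutativeRing)
import Algebra.Properties.Ring as RingProperties
import Algebra.Properties.Semiring.Mult as Mult
import Algebra.Properties.Semiring.Mult.TCOptimised as Mult′
import Algebra.Solver.Ring as RingSolver
open import Algebra.Solver.Ring.AlmostCommutativeRing using (fromCommutativeRing; _-Raw-AlmostCommutative⟶_)
open import Data.Empty using (⊥; ⊥-elim)
open import Data.Integer.Base as ℤ using (ℤ; +_; -[1+_]; _⊖_; _◃_)
import Data.Integer.Properties as ℤ
open import Data.List.Base using (List; []; _∷_; map; cartesianProduct)
import Data.List.Extrema as Extrema
open import Data.List.NonEmpty.Base using (_∷_)
open import Data.List.NonEmpty.Relation.Unary.All as All⁺ using (_∷_)
open import Data.List.Relation.Unary.All as All using (All; []; _∷_)
import Data.List.Relation.Unary.All.Properties as All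
open import Data.List.Relation.Unary.Any using (Any; here; there)
import Data.List.Relation.Unary.Any.Properties as Any
open import Data.Maybe.Base using (just; nothing)
open import Data.Nat.Base as ℕ using (zero; suc)
import Data.Nat.Properties as ℕ
open import Data.Product.Base using (_×_; _,_; ∃; ∃₂; proj₁; proj₂)
open import Data.Sign.Base as Sign using ()
open import Data.Sum.Base using (_⊎_; inj₁; inj₂)
open import Data.Unit.Base using (tt)
open import Function.Base using (case_of_; _∘_)
open import Function.Bundles using (Func; _⇔_; mk⇔)
open import Level using (0ℓ)
open import Relation.Binary.Definitions using (WeaklyDecidable)
import Relation.Binary.PropositionalEquality.Core as ≡
import Relation.Binary.Reasoning.Setoid as SetoidReasoning
open import Relation.Binary.Structures using (IsTotalOrder)
open import Relation.Nullary using (¬_; yes; no)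
open import Relation.Unary using (Pred; U)

-- Separate convexity does not imply convexity: `x * y` is affine on every row and column and
-- concave along `y = - x`. Integrality excludes such functions. A positive integral slope is at
-- least 1, so a row that is ≤ 0 at one point and small enough at some distance cannot become
-- positive in between. This turns affineness on a cross into affineness on a neighbourhood, with no
-- second derivative taken. The touching function is quadratic across a segment and linear along it;
-- strictness comes from choosing the leftmost maximiser. It arises from maximising
-- `f x y + κ * x - K * (u * u)` over a strip of parallel segments, `u` being the offset of the
-- segment. Such maxima have to be attained, hence the attention to upper semicontinuity, the half
-- of continuity that convexity yields most directly. Convexity along lines enters in the one form
-- that supporting planes call for: a function that is nonnegative on a column and ≤ 0 at a point on
-- one side of it is nonnegative on the other side.

module _ (em : ExcludedMiddle 0ℓ) (R : CompleteOrderedField) where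

  open CompleteOrderedField R renaming (Carrier to ℝ)
  open CommutativeRing commutativeRing
    using (_-_; refl; sym; trans; reflexive; +-cong; +-congˡ; +-congʳ; *-congˡ; *-congʳ; *-cong; -‿cong;
           +-assoc; +-comm; +-identityˡ; +-identityʳ; *-identityˡ; *-identityʳ; zeroʳ; -‿inverseʳ)
  open IsTotalOrder isTotalOrder using (antisym; total)
    renaming (refl to ≤-refl; trans to ≤-trans; reflexive to ≤-reflexive)
  open Plane R
  open AffineFunctional using (eval; a₁; a₂)
  open Extrema totalOrder using (max; v≤max⁺; max≤v⁺; ⊥≤max; xs≤max)
  private
    module CR = CommutativeRing commutativeRing
    module M  = Mult CR.semiring
    module M′ = Mult′ CR.semiring
  open RingProperties CR.ring
    using (-0#≈0#; -‿distribˡ-*; -‿distribʳ-*; -‿involutive; -‿+-comm)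
  open SetoidReasoning setoid

  -- The integers inside the reals, and the ring solver

  fromℤ-⊖ : ∀ m n → fromℤ (m ⊖ n) ≈ m M.× 1# - n M.× 1#
  fromℤ-⊖ m       zero    = sym (trans (+-congˡ -0#≈0#) (+-identityʳ _))
  fromℤ-⊖ zero    (suc n) = sym (+-identityˡ _)
  fromℤ-⊖ (suc m) (suc n) = begin
    fromℤ (suc m ⊖ suc n)                 ≡⟨ ≡.cong fromℤ (ℤ.[1+m]⊖[1+n]≡m⊖n m n) ⟩
    fromℤ (m ⊖ n)                         ≈⟨ fromℤ-⊖ m n ⟩
    a - b                                 ≈⟨ +-congʳ (+-identityˡ a) ⟨
    (0# + a) - b                          ≈⟨ +-congʳ (+-congʳ (-‿inverseʳ 1#)) ⟨
    (1# - 1# + a) - b                     ≈⟨ +-congʳ (+-assoc 1# (- 1#) a) ⟩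
    1# + (- 1# + a) - b                   ≈⟨ +-congʳ (+-congˡ (+-comm (- 1#) a)) ⟩
    1# + (a - 1#) - b                     ≈⟨ +-congʳ (+-assoc 1# a (- 1#)) ⟨
    1# + a - 1# - b                       ≈⟨ +-assoc (1# + a) (- 1#) (- b) ⟩
    1# + a + (- 1# - b)                   ≈⟨ +-congˡ (-‿+-comm 1# b) ⟩
    (1# + a) - (1# + b)                   ∎
    where a = m M.× 1#
          b = n M.× 1#

  fromℤ-+ : ∀ i j → fromℤ (i ℤ.+ j) ≈ fromℤ i + fromℤ j
  fromℤ-+ (+ m)    (+ n)    = M.×-homo-+ 1# m n
  fromℤ-+ (+ m)    -[1+ n ] = fromℤ-⊖ m (suc n)
  fromℤ-+ -[1+ m ] (+ n)    = trans (fromℤ-⊖ n (suc m)) (+-comm _ _)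
  fromℤ-+ -[1+ m ] -[1+ n ] = trans
    (-‿cong (trans (reflexive (≡.cong (λ k → suc k M.× 1#) (≡.sym (ℕ.+-suc m n)))) (M.×-homo-+ 1# (suc m) (suc n))))
    (sym (-‿+-comm _ _))

  fromℤ-neg : ∀ i → fromℤ (ℤ.- i) ≈ - fromℤ i
  fromℤ-neg (+ zero)  = sym -0#≈0#
  fromℤ-neg (+ suc n) = refl
  fromℤ-neg -[1+ n ]  = sym (-‿involutive _)

  fromℤ-+◃ : ∀ n → fromℤ (Sign.+ ◃ n) ≈ n M.× 1#
  fromℤ-+◃ zero    = refl
  fromℤ-+◃ (suc n) = refl

  fromℤ--◃ : ∀ n → fromℤ (Sign.- ◃ n) ≈ - (n M.× 1#)
  fromℤ--◃ zero    = sym -0#≈0#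
  fromℤ--◃ (suc n) = refl

  fromℤ-* : ∀ i j → fromℤ (i ℤ.* j) ≈ fromℤ i * fromℤ j
  fromℤ-* (+ m)    (+ n)    = trans (fromℤ-+◃ (m ℕ.* n)) (M.×1-homo-* m n)
  fromℤ-* (+ m)    -[1+ n ] = trans (fromℤ--◃ (m ℕ.* suc n))
    (trans (-‿cong (M.×1-homo-* m (suc n))) (-‿distribʳ-* _ _))
  fromℤ-* -[1+ m ] (+ n)    = trans (fromℤ--◃ (suc m ℕ.* n))
    (trans (-‿cong (M.×1-homo-* (suc m) n)) (-‿distribˡ-* _ _))
  fromℤ-* -[1+ m ] -[1+ n ] = begin
    (suc m ℕ.* suc n) M.× 1#               ≈⟨ M.×1-homo-* (suc m) (suc n) ⟩
    (suc m M.× 1#) * (suc n M.× 1#)        ≈⟨ -‿involutive _ ⟨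
    - - ((suc m M.× 1#) * (suc n M.× 1#))  ≈⟨ -‿cong (-‿distribʳ-* _ _) ⟩
    - ((suc m M.× 1#) * - (suc n M.× 1#))  ≈⟨ -‿distribˡ-* _ _ ⟩
    - (suc m M.× 1#) * - (suc n M.× 1#)    ∎

  -- Unlike fromℤ, this embedding sends 1 to 1# definitionally, so that the
  -- literals of the ring solver denote the expected reals.
  fromℤ′ : ℤ → ℝ
  fromℤ′ (+ n)    = n M′.× 1#
  fromℤ′ -[1+ n ] = - (suc n M′.× 1#)

  fromℤ′≈fromℤ : ∀ i → fromℤ′ i ≈ fromℤ i
  fromℤ′≈fromℤ (+ n)    = sym (M′.×ᵤ≈× n 1#)
  fromℤ′≈fromℤ -[1+ n ] = -‿cong (sym (M′.×ᵤ≈× (suc n) 1#))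

  private
    morphism : ℤ.+-*-rawRing -Raw-AlmostCommutative⟶ fromCommutativeRing commutativeRing
    morphism = record
      { ⟦_⟧    = fromℤ′
      ; +-homo = λ i j → trans (fromℤ′≈fromℤ (i ℤ.+ j)) (trans (fromℤ-+ i j)
                   (sym (+-cong (fromℤ′≈fromℤ i) (fromℤ′≈fromℤ j))))
      ; *-homo = λ i j → trans (fromℤ′≈fromℤ (i ℤ.* j)) (trans (fromℤ-* i j)
                   (sym (*-cong (fromℤ′≈fromℤ i) (fromℤ′≈fromℤ j))))
      ; -‿homo = λ i → trans (fromℤ′≈fromℤ (ℤ.- i)) (trans (fromℤ-neg i)
                   (sym (-‿cong (fromℤ′≈fromℤ i))))
      ; 0-homo = refl
      ; 1-homo = refl
      }

    coeff≟ : WeaklyDecidable (λ i j → fromℤ′ i ≈ fromℤ′ j)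
    coeff≟ i j with i ℤ.≟ j
    ... | yes ≡.refl = just refl
    ... | no _       = nothing

  module Solver = RingSolver ℤ.+-*-rawRing (fromCommutativeRing commutativeRing) morphism coeff≟
  open Solver using (solve; _:=_; con; _:+_; _:*_; _:-_; :-_)

  -- The order

  infix 4 _<_
  _<_ : ℝ → ℝ → Set
  x < y = ¬ (y ≤ x)

  infixl 6 _⊞_ _⊞<_
  infixl 7 _⊠_ _⊠<_

  opaque
    <⇒≤ : ∀ {x y} → x < y → x ≤ y
    <⇒≤ {x} {y} x<y with total x y
    ... | inj₁ x≤y = x≤y
    ... | inj₂ y≤x = ⊥-elim (x<y y≤x)

    ≤-<-connex : ∀ x y → x ≤ y ⊎ y < x
    ≤-<-connex x y with em {x ≤ y}
    ... | yes x≤y = inj₁ x≤y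
    ... | no  x≰y = inj₂ x≰y

    ≮⇒≥ : ∀ {x y} → ¬ (x < y) → y ≤ x
    ≮⇒≥ {x} {y} x≮y with ≤-<-connex y x
    ... | inj₁ y≤x = y≤x
    ... | inj₂ x<y = ⊥-elim (x≮y x<y)

    ≤-resp : ∀ {x x′ y y′} → x ≈ x′ → y ≈ y′ → x ≤ y → x′ ≤ y′
    ≤-resp p q x≤y = ≤-trans (≤-reflexive (sym p)) (≤-trans x≤y (≤-reflexive q))

    <-resp : ∀ {x x′ y y′} → x ≈ x′ → y ≈ y′ → x < y → x′ < y′
    <-resp p q x<y y′≤x′ = x<y (≤-resp (sym q) (sym p) y′≤x′)

    ≤-<-trans : ∀ {x y z} → x ≤ y → y < z → x < z
    ≤-<-trans x≤y y<z z≤x = y<z (≤-trans z≤x x≤y)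

    <-≤-trans : ∀ {x y z} → x < y → y ≤ z → x < z
    <-≤-trans x<y y≤z z≤x = x<y (≤-trans y≤z z≤x)

    gap : ∀ {x y} → x ≤ y → 0# ≤ y - x
    gap {x} x≤y = ≤-resp (-‿inverseʳ x) refl (+-monoˡ-≤ (- x) x≤y)

    ungap : ∀ {x y} → 0# ≤ y - x → x ≤ y
    ungap {x} {y} p = ≤-resp (+-identityˡ x)
      (solve 2 (λ x y → y :- x :+ x := y) refl x y) (+-monoˡ-≤ x p)

    gap< : ∀ {x y} → x < y → 0# < y - x
    gap< {x} {y} x<y p = x<y (≤-resp (solve 2 (λ x y → y :- x :+ x := y)
      refl x y) (+-identityˡ x) (+-monoˡ-≤ x p))

    gap≈ : ∀ {x y} → x ≈ y → 0# ≤ y - x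
    gap≈ x≈y = gap (≤-reflexive x≈y)

    -- Inequalities are proved by exhibiting the difference of their sides as a
    -- sum of products of quantities of known sign; the ring solver checks the
    -- identity.
    by : ∀ {c x y} → 0# ≤ c → c ≈ y - x → x ≤ y
    by p e = ungap (≤-resp refl e p)

    by< : ∀ {c x y} → 0# < c → c ≈ y - x → x < y
    by< {c} {x} {y} p e y≤x = p (by (gap y≤x) (trans
      (solve 2 (λ x y → x :- y := con (+ 0) :- (y :- x)) refl x y)
      (+-congˡ (-‿cong (sym e)))))

    _⊞_ : ∀ {a b} → 0# ≤ a → 0# ≤ b → 0# ≤ a + b
    _⊞_ {a} {b} p q = ≤-trans q (≤-resp (+-identityˡ b) refl (+-monoˡ-≤ b p))

    _⊠_ : ∀ {a b} → 0# ≤ a → 0# ≤ b → 0# ≤ a * b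
    _⊠_ = *-nonNeg

    _⊞<_ : ∀ {a b} → 0# < a → 0# ≤ b → 0# < a + b
    _⊞<_ {a} {b} p q r = p (by (q ⊞ gap r) (solve 2 (λ a b → b :+ (con (+ 0) :- (a :+ b)) := con (+ 0) :- a)
      refl a b))

    0≤1 : 0# ≤ 1#
    0≤1 with total 0# 1#
    ... | inj₁ p = p
    ... | inj₂ p = by (gap p ⊠ gap p) (solve 0 ((con (+ 0) :- con (+ 1)) :* (con (+ 0) :- con (+ 1))
      := con (+ 1) :- con (+ 0)) refl)

    0<1 : 0# < 1#
    0<1 p = 0≉1 (antisym 0≤1 p)

    >⇒≉ : ∀ {x y} → x < y → ¬ (y ≈ x)
    >⇒≉ x<y y≈x = x<y (≤-reflexive y≈x)

    _⊠<_ : ∀ {a b} → 0# < a → 0# < b → 0# < a * b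
    _⊠<_ {a} {b} 0<a 0<b ab≤0 with inverse a (>⇒≉ 0<a)
    ... | a⁻¹ , aa⁻¹≈1 = >⇒≉ 0<b b≈0
      where
      ab≈0 : a * b ≈ 0#
      ab≈0 = antisym ab≤0 (<⇒≤ 0<a ⊠ <⇒≤ 0<b)
      b≈0 : b ≈ 0#
      b≈0 = trans (sym (*-identityˡ b)) (trans (*-congʳ (sym aa⁻¹≈1))
        (trans (solve 3 (λ a i b → a :* i :* b := i :* (a :* b)) refl a a⁻¹ b)
        (trans (*-congˡ ab≈0) (zeroʳ a⁻¹))))

    reciprocal : ∀ {x} → 0# < x → ∃ λ y → 0# < y × x * y ≈ 1#
    reciprocal {x} 0<x with inverse x (>⇒≉ 0<x)
    ... | y , xy≈1 = y , 0<y , xy≈1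
      where
      0<y : 0# < y
      0<y y≤0 = 0<1 (≤-resp xy≈1 refl (by (<⇒≤ 0<x ⊠ gap y≤0)
        (solve 2 (λ x y → x :* (con (+ 0) :- y) := con (+ 0) :- x :* y) refl x y)))

    halve : ∀ {e} → 0# < e → ∃ λ h → 0# < h × h + h ≈ e
    halve {e} 0<e = let ½ , 0<½ , 2½≈1 = reciprocal {1# + 1#} (0<1 ⊞< 0≤1) in
      e * ½ , 0<e ⊠< 0<½ ,
      trans (solve 2 (λ e h → e :* h :+ e :* h := e :* ((con (+ 1) :+ con (+ 1)) :* h)) refl e ½)
            (trans (*-congˡ 2½≈1) (*-identityʳ _))

    _≤∧≤_ : ∀ {a b} → 0# < a → 0# < b → ∃ λ c → 0# < c × c ≤ a × c ≤ b
    _≤∧≤_ {a} {b} 0<a 0<b with total a b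
    ... | inj₁ a≤b = a , 0<a , ≤-refl , a≤b
    ... | inj₂ b≤a = b , 0<b , b≤a , ≤-refl

    upperBound : ∀ a b → ∃ λ c → a ≤ c × b ≤ c
    upperBound a b with total a b
    ... | inj₁ a≤b = b , a≤b , ≤-refl
    ... | inj₂ b≤a = a , ≤-refl , b≤a

    between : ∀ {x y} → x < y → ∃ λ z → x < z × z < y
    between {x} {y} x<y = let h , 0<h , 2h≈ = halve (gap< x<y) in x + h ,
      by< 0<h (solve 2 (λ x h → h := x :+ h :- x) refl x h) ,
      <-resp refl (trans (+-congˡ 2h≈) (solve 2 (λ x y → x :+ (y :- x) := y) refl x y))
        (by< 0<h (solve 2 (λ x h → h := x :+ (h :+ h) :- (x :+ h)) refl x h))

    neg≤0 : ∀ {x} → 0# ≤ x → - x ≤ 0#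
    neg≤0 {x} p = by p (solve 1 (λ x → x := con (+ 0) :- :- x) refl x)

    0≤neg : ∀ {x} → x ≤ 0# → 0# ≤ - x
    0≤neg {x} p = by (gap p) (solve 1 (λ x → con (+ 0) :- x := :- x :- con (+ 0)) refl x)

    neg-mono : ∀ {x y} → x ≤ y → - y ≤ - x
    neg-mono {x} {y} p = by (gap p) (solve 2 (λ x y → y :- x := :- x :- :- y) refl x y)

    -- `δ` is `e / (1 + c)`, where `c` bounds the absolute value of `C`. The 1 keeps the denominator
    -- positive and leaves the margin `δ` that makes the bound strict.
    small-multiple : ∀ C {e} → 0# < e →
      ∃ λ δ → 0# < δ × (∀ t → - δ ≤ t → t ≤ δ → C * t < e)
    small-multiple C {e} 0<e =
      let c , C≤c , -C≤c = upperBound C (- C)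
          0≤c : 0# ≤ c
          0≤c = case total 0# C of λ
            { (inj₁ 0≤C) → ≤-trans 0≤C C≤c
            ; (inj₂ C≤0) → ≤-trans (0≤neg C≤0) -C≤c }
          i , 0<i , [1+c]i≈1 = reciprocal {1# + c} (0<1 ⊞< 0≤c)
      in e * i , 0<e ⊠< 0<i , bound c C≤c -C≤c 0≤c (e * i) (0<e ⊠< 0<i)
        (trans (solve 3 (λ c e i → (con (+ 1) :+ c) :* (e :* i) := e :* ((con (+ 1) :+ c) :* i)) refl c e i)
          (trans (*-congˡ [1+c]i≈1) (*-identityʳ _)))
      where
      module _ (c : ℝ) (C≤c : C ≤ c) (-C≤c : - C ≤ c) (0≤c : 0# ≤ c)
               (δ : ℝ) (0<δ : 0# < δ) ([1+c]δ≈e : (1# + c) * δ ≈ e) where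
        bound : ∀ t → - δ ≤ t → t ≤ δ → C * t < e
        bound t -δ≤t t≤δ with total 0# t
        ... | inj₁ 0≤t = <-resp refl [1+c]δ≈e (by< (0<δ ⊞< (gap C≤c ⊠ 0≤t ⊞ 0≤c ⊠ gap t≤δ))
          (solve 4 (λ C c δ t → δ :+ ((c :- C) :* t :+ c :* (δ :- t)) := (con (+ 1) :+ c) :* δ :- C :* t)
            refl C c δ t))
        ... | inj₂ t≤0 = <-resp refl [1+c]δ≈e (by< (0<δ ⊞< (gap -C≤c ⊠ gap t≤0 ⊞ 0≤c ⊠ gap -δ≤t))
          (solve 4 (λ C c δ t → δ :+ ((c :- :- C) :* (con (+ 0) :- t) :+ c :* (t :- :- δ))
            := (con (+ 1) :+ c) :* δ :- C :* t) refl C c δ t))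

    fromℤ-nonneg : ∀ n → 0# ≤ fromℤ (+ n)
    fromℤ-nonneg zero    = ≤-refl
    fromℤ-nonneg (suc n) = 0≤1 ⊞ fromℤ-nonneg n

    IsInteger-resp : ∀ {a b} → a ≈ b → IsInteger a → IsInteger b
    IsInteger-resp a≈b (i , a≈i) = i , trans (sym a≈b) a≈i

    IsInteger-0 : IsInteger 0#
    IsInteger-0 = + 0 , refl

    IsInteger-neg : ∀ {a} → IsInteger a → IsInteger (- a)
    IsInteger-neg (i , a≈i) = ℤ.- i , trans (-‿cong a≈i) (sym (fromℤ-neg i))

    IsInteger-+ : ∀ {a b} → IsInteger a → IsInteger b → IsInteger (a + b)
    IsInteger-+ (i , a≈i) (j , b≈j) = i ℤ.+ j , trans (+-cong a≈i b≈j) (sym (fromℤ-+ i j))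

    IsInteger-fromℕ : ∀ n → IsInteger (fromℤ (+ n))
    IsInteger-fromℕ n = + n , refl

    -- Discreteness of ℤ, used to make small convex functions vanish and to list the integers of an
    -- interval.
    integer-gap : ∀ {a b} → IsInteger a → IsInteger b → a < b → 1# + a ≤ b
    integer-gap {a} {b} a∈ℤ b∈ℤ a<b = by (gap (positive (IsInteger-+ b∈ℤ (IsInteger-neg a∈ℤ)) (gap< a<b)))
      (solve 2 (λ a b → b :- a :- con (+ 1) := b :- (con (+ 1) :+ a)) refl a b)
      where
      positive : ∀ {d} → IsInteger d → 0# < d → 1# ≤ d
      positive (+ zero , d≈)  0<d = ⊥-elim (0<d (≤-reflexive d≈))
      positive (+ suc n , d≈) 0<d = ≤-resp refl (sym d≈)
        (by (fromℤ-nonneg n) (solve 1 (λ n → n := con (+ 1) :+ n :- con (+ 1)) refl (fromℤ (+ n))))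
      positive (-[1+ n ] , d≈) 0<d = ⊥-elim (0<d (≤-resp (sym d≈) refl (neg≤0 (fromℤ-nonneg (suc n)))))

    -- If all naturals lay below `x`, they would have a supremum `s`; but `s - 1#` would bound them
    -- too, since `1# + n` is again a natural.
    archimedean : ∀ x → ∃ λ n → x ≤ fromℤ (+ n)
    archimedean x with em {∃ λ n → x ≤ fromℤ (+ n)}
    ... | yes p = p
    ... | no ¬p =
      let s , s-ub , s-least = supremum (λ v → ∃ λ n → v ≈ fromℤ (+ n)) (0# , 0 , refl)
            (x , λ v (n , v≈n) → ≤-resp (sym v≈n) refl (<⇒≤ λ x≤n → ¬p (n , x≤n)))
      in ⊥-elim (by< 0<1 (solve 1 (λ s → con (+ 1) := s :- (s :- con (+ 1))) refl s)
        (s-least (s - 1#) λ v (n , v≈n) → ≤-resp (sym v≈n) refl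
          (by (gap (s-ub _ (suc n , refl)))
            (solve 2 (λ s n → s :- (con (+ 1) :+ n) := s :- con (+ 1) :- n) refl s (fromℤ (+ n))))))

  -- Functions of one variable

  opaque
    *-cancelʳ-≤ : ∀ {x y z} → 0# < z → x * z ≤ y * z → x ≤ y
    *-cancelʳ-≤ {x} {y} {z} 0<z xz≤yz = ≮⇒≥ λ y<x →
      by< (gap< y<x ⊠< 0<z) (solve 3 (λ x y z → (x :- y) :* z := x :* z :- y :* z) refl x y z) xz≤yz

    upperBound< : ∀ {x y z} → x < z → y < z → ∃ λ m → x ≤ m × y ≤ m × m < z
    upperBound< {x} {y} x<z y<z = case total x y of λ
      { (inj₁ x≤y) → y , x≤y , ≤-refl , y<z
      ; (inj₂ y≤x) → x , ≤-refl , y≤x , x<z }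

    x-δ<x : ∀ x {δ} → 0# < δ → x - δ < x
    x-δ<x x {δ} 0<δ = by< 0<δ (solve 2 (λ x δ → δ := x :- (x :- δ)) refl x δ)

    x<x+δ : ∀ x {δ} → 0# < δ → x < x + δ
    x<x+δ x {δ} 0<δ = by< 0<δ (solve 2 (λ x δ → δ := x :+ δ :- x) refl x δ)

  UpperSemicontinuous : (ℝ → ℝ) → Set
  UpperSemicontinuous g = ∀ x {e} → 0# < e →
    ∃ λ δ → 0# < δ × (∀ t → x - δ ≤ t → t ≤ x + δ → g t < g x + e)

  opaque
    widen- : ∀ {x δ ε t} → δ ≤ ε → x - δ ≤ t → x - ε ≤ t
    widen- {x} {δ} {ε} {t} p q = by (gap p ⊞ gap q)
      (solve 4 (λ x δ ε t → ε :- δ :+ (t :- (x :- δ)) := t :- (x :- ε)) refl x δ ε t)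

    widen+ : ∀ {x δ ε t} → δ ≤ ε → t ≤ x + δ → t ≤ x + ε
    widen+ {x} {δ} {ε} {t} p q = by (gap p ⊞ gap q)
      (solve 4 (λ x δ ε t → ε :- δ :+ (x :+ δ :- t) := x :+ ε :- t) refl x δ ε t)

    usc-+ : ∀ {g h} → UpperSemicontinuous g → UpperSemicontinuous h →
            UpperSemicontinuous (λ x → g x + h x)
    usc-+ {g} {h} g-usc h-usc x {e} 0<e =
      let e/2 , 0<e/2 , 2e/2≈e = halve 0<e
          δ₁ , 0<δ₁ , g<       = g-usc x 0<e/2
          δ₂ , 0<δ₂ , h<       = h-usc x 0<e/2
          δ , 0<δ , δ≤δ₁ , δ≤δ₂ = 0<δ₁ ≤∧≤ 0<δ₂
      in δ , 0<δ , λ t x-δ≤t t≤x+δ → <-resp refl (+-congˡ 2e/2≈e)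
        (by< (gap< (g< t (widen- δ≤δ₁ x-δ≤t) (widen+ δ≤δ₁ t≤x+δ)) ⊞<
              <⇒≤ (gap< (h< t (widen- δ≤δ₂ x-δ≤t) (widen+ δ≤δ₂ t≤x+δ))))
          (solve 5 (λ gx gt hx ht e → gx :+ e :- gt :+ (hx :+ e :- ht) := gx :+ hx :+ (e :+ e) :- (gt :+ ht))
            refl (g x) (g t) (h x) (h t) e/2))

    -δ≤t-x : ∀ {x δ t} → x - δ ≤ t → - δ ≤ t - x
    -δ≤t-x {x} {δ} {t} p = by (gap p) (solve 3 (λ x δ t → t :- (x :- δ) := t :- x :- :- δ) refl x δ t)

    t-x≤δ : ∀ {x δ t} → t ≤ x + δ → t - x ≤ δ
    t-x≤δ {x} {δ} {t} p = by (gap p) (solve 3 (λ x δ t → x :+ δ :- t := δ :- (t :- x)) refl x δ t)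

    usc-linear : ∀ k → UpperSemicontinuous (λ x → k * x)
    usc-linear k x {e} 0<e =
      let δ , 0<δ , small = small-multiple k 0<e
      in δ , 0<δ , λ t p q → by< (gap< (small (t - x) (-δ≤t-x p) (t-x≤δ q)))
        (solve 4 (λ k x e t → e :- k :* (t :- x) := k :* x :+ e :- k :* t) refl k x e t)

    square : ∀ d → 0# ≤ d * d
    square d = case total 0# d of λ
      { (inj₁ 0≤d) → 0≤d ⊠ 0≤d
      ; (inj₂ d≤0) → ≤-resp refl (solve 1 (λ d → (con (+ 0) :- d) :* (con (+ 0) :- d) := d :* d) refl d)
                       (gap d≤0 ⊠ gap d≤0) }

    usc-concaveQuadratic : ∀ {K} → 0# ≤ K → UpperSemicontinuous (λ x → - (K * (x * x)))
    usc-concaveQuadratic {K} 0≤K x {e} 0<e =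
      let δ , 0<δ , small = small-multiple (- (K * x + K * x)) 0<e
      in δ , 0<δ , λ t p q → by< (gap< (small (t - x) (-δ≤t-x p) (t-x≤δ q)) ⊞< 0≤K ⊠ square (t - x))
        (solve 4 (λ K x e t → e :- (:- (K :* x :+ K :* x)) :* (t :- x) :+ K :* ((t :- x) :* (t :- x))
                   := :- (K :* (x :* x)) :+ e :- :- (K :* (t :* t))) refl K x e t)

    -- Let `V` be the supremum of the values, which exists because of the bound `C`. The maximiser
    -- is the supremum `s` of those `x` for which the values on `[a, x]` stay under some `v < V`.
    -- Were `g s < V`, upper semicontinuity would carry such a bound beyond `s`; and every point
    -- left of `s` lies under one of these bounds, so `s` is leftmost.
    leftmostMaximum : ∀ {g a b C} → a ≤ b → UpperSemicontinuous g → (∀ t → a ≤ t → t ≤ b → g t ≤ C) →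
      ∃ λ x → a ≤ x × x ≤ b × (∀ t → a ≤ t → t ≤ b → g t ≤ g x) × (∀ t → a ≤ t → t < x → g t < g x)
    leftmostMaximum {g} {a} {b} {C} a≤b g-usc g≤C = s , a≤s , s≤b , maximal , leftmost
      where
      Value : Pred ℝ 0ℓ
      Value v = ∃ λ t → a ≤ t × t ≤ b × v ≈ g t
      supValue : ∃ λ s → s IsUpperBoundOf Value × (∀ u → u IsUpperBoundOf Value → s ≤ u)
      supValue = supremum Value (g a , a , ≤-refl , a≤b , refl)
        (C , λ v (t , a≤t , t≤b , v≈) → ≤-resp (sym v≈) refl (g≤C t a≤t t≤b))
      V : ℝ
      V = proj₁ supValue
      g≤V : ∀ t → a ≤ t → t ≤ b → g t ≤ V
      g≤V t a≤t t≤b = proj₁ (proj₂ supValue) (g t) (t , a≤t , t≤b , refl)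
      V≤ : ∀ {u} → (∀ t → a ≤ t → t ≤ b → g t ≤ u) → V ≤ u
      V≤ {u} p = proj₂ (proj₂ supValue) u λ v (t , a≤t , t≤b , v≈) → ≤-resp (sym v≈) refl (p t a≤t t≤b)

      Low : Pred ℝ 0ℓ
      Low x = x ≤ b × ∃ λ v → v < V × (∀ t → a ≤ t → t ≤ x → g t ≤ v)
      -- Points left of `a` satisfy the bound vacuously, so the set is inhabited before anything is
      -- known about `g a`.
      low-below : ∀ {x} → x < a → Low x
      low-below x<a = ≤-trans (<⇒≤ x<a) a≤b , V - 1# , x-δ<x V 0<1 ,
        λ t a≤t t≤x → ⊥-elim (x<a (≤-trans a≤t t≤x))
      supLow : ∃ λ s → s IsUpperBoundOf Low × (∀ u → u IsUpperBoundOf Low → s ≤ u)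
      supLow = supremum Low (a - 1# , low-below (x-δ<x a 0<1)) (b , λ x low → proj₁ low)
      s : ℝ
      s = proj₁ supLow
      s-ub : ∀ {x} → Low x → x ≤ s
      s-ub {x} = proj₁ (proj₂ supLow) x
      s≤b : s ≤ b
      s≤b = proj₂ (proj₂ supLow) b λ x low → proj₁ low
      a≤s : a ≤ s
      a≤s = ≮⇒≥ λ s<a → let m , s<m , m<a = between s<a in s<m (s-ub (low-below m<a))
      approach : ∀ {y} → y < s → ∃ λ x → Low x × y < x
      approach {y} y<s with em {∃ λ x → Low x × y < x}
      ... | yes p = p
      ... | no ¬p = ⊥-elim (y<s (proj₂ (proj₂ supLow) y λ x low → ≮⇒≥ λ y<x → ¬p (x , low , y<x)))

      V≤gs : V ≤ g s
      V≤gs = ≮⇒≥ λ gs<V →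
        let v′ , gs<v′ , v′<V    = between gs<V
            δ , 0<δ , near       = g-usc s (gap< gs<v′)
            x , (_ , v , v<V , g≤v) , s-δ<x = approach (x-δ<x s 0<δ)
            m , v≤m , v′≤m , m<V = upperBound< v<V v′<V
            g≤m : ∀ t → a ≤ t → t ≤ s + δ → g t ≤ m
            g≤m t a≤t t≤s+δ = case total t x of λ
              { (inj₁ t≤x) → ≤-trans (g≤v t a≤t t≤x) v≤m
              ; (inj₂ x≤t) → ≤-trans (<⇒≤ (<-resp refl
                  (solve 2 (λ gs v → gs :+ (v :- gs) := v) refl (g s) v′)
                  (near t (≤-trans (<⇒≤ s-δ<x) x≤t) t≤s+δ))) v′≤m }
        -- Either the bound `m < V` covers all of `[a, b]`, against the minimality of `V`, or
        -- `s + δ` is in `Low`, against the choice of `s`.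
        in case total b (s + δ) of λ
          { (inj₁ b≤s+δ) → m<V (V≤ λ t a≤t t≤b → g≤m t a≤t (≤-trans t≤b b≤s+δ))
          ; (inj₂ s+δ≤b) → x<x+δ s 0<δ (s-ub (s+δ≤b , m , m<V , g≤m)) }

      maximal : ∀ t → a ≤ t → t ≤ b → g t ≤ g s
      maximal t a≤t t≤b = ≤-trans (g≤V t a≤t t≤b) V≤gs
      leftmost : ∀ t → a ≤ t → t < s → g t < g s
      leftmost t a≤t t<s =
        let x , (_ , v , v<V , g≤v) , t<x = approach t<s
        in ≤-<-trans (g≤v t a≤t (<⇒≤ t<x)) (<-≤-trans v<V V≤gs)

  -- One-sided germs and integral convexity

  record Germ (ω : ℝ → ℝ) (v : ℝ) : Set where
    field
      slope    : ℝ
      integral : IsInteger slope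
      radius   : ℝ
      radius>0 : 0# < radius
      affine   : ∀ t → 0# ≤ t → t ≤ radius → ω t ≈ v + slope * t

  -- The slope of the left germ is measured away from x, in the direction −1.
  record IntegralConvex (φ : ℝ → ℝ) : Set where
    field
      φ-cong  : ∀ {x y} → x ≈ y → φ x ≈ φ y
      right   : ∀ x → Germ (λ t → φ (x + t)) (φ x)
      left    : ∀ x → Germ (λ t → φ (x - t)) (φ x)
      -- Convexity is expressed by a supporting line at every point. The slope can be taken
      -- integral, since that of the right germ serves.
      support : ∀ x → ∃ λ a → IsInteger a × (∀ y → φ x + a * (y - x) ≤ φ y)

  opaque
    mirror : ∀ {φ} → IntegralConvex φ → IntegralConvex (λ x → φ (- x))
    mirror {φ} φ-ic = record
      { φ-cong  = λ x≈y → φ-cong (-‿cong x≈y)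
      ; right   = λ x → reparametrise (left (- x)) λ t →
                    φ-cong (solve 2 (λ x t → :- (x :+ t) := :- x :- t) refl x t)
      ; left    = λ x → reparametrise (right (- x)) λ t →
                    φ-cong (solve 2 (λ x t → :- (x :- t) := :- x :+ t) refl x t)
      ; support = λ x → let a , a∈ℤ , supp = support (- x) in - a , IsInteger-neg a∈ℤ , λ y →
                    ≤-resp (+-congˡ (solve 3 (λ a x y → a :* (:- y :- :- x) := :- a :* (y :- x)) refl a x y))
                      refl (supp (- y))
      }
      where
      open IntegralConvex φ-ic
      reparametrise : ∀ {ω ω′ v} → Germ ω v → (∀ t → ω′ t ≈ ω t) → Germ ω′ v
      reparametrise γ ω′≈ω = record
        { slope = slope ; integral = integral ; radius = radius ; radius>0 = radius>0
        ; affine = λ t p q → trans (ω′≈ω t) (affine t p q) }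
        where open Germ γ

    -- Normalisation at a point: an affine function is subtracted so that comparison is with 0. Its
    -- slope has to be an integer for germs and supports to stay integral. Left slopes gain `k`
    -- because they are measured leftwards.
    tilt : ∀ {φ ψ x₀ k c} → IntegralConvex φ → IsInteger k → (∀ x → ψ x ≈ φ (x₀ + x) - (k * x + c)) →
           IntegralConvex ψ
    tilt {φ} {ψ} {x₀} {k} {c} φ-ic k∈ℤ ψ≈ = record
      { φ-cong  = λ {x} {y} x≈y → trans (ψ≈ x) (trans
                    (+-cong (φ-cong (+-congˡ x≈y)) (-‿cong (+-congʳ (*-congˡ x≈y)))) (sym (ψ≈ y)))
      ; right   = λ x → let open Germ (right (x₀ + x)) in record
          { slope = slope - k ; integral = IsInteger-+ integral (IsInteger-neg k∈ℤ)
          ; radius = radius ; radius>0 = radius>0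
          ; affine = λ t 0≤t t≤r → trans (ψ≈ (x + t)) (trans
              (+-congʳ (trans (φ-cong (solve 3 (λ x₀ x t → x₀ :+ (x :+ t) := x₀ :+ x :+ t)
                refl x₀ x t)) (affine t 0≤t t≤r)))
              (trans (solve 6 (λ v s t k x c → v :+ s :* t :- (k :* (x :+ t) :+ c)
                := v :- (k :* x :+ c) :+ (s :- k) :* t)
                        refl (φ (x₀ + x)) slope t k x c)
                (+-congʳ (sym (ψ≈ x))))) }
      ; left    = λ x → let open Germ (left (x₀ + x)) in record
          { slope = slope + k ; integral = IsInteger-+ integral k∈ℤ
          ; radius = radius ; radius>0 = radius>0
          ; affine = λ t 0≤t t≤r → trans (ψ≈ (x - t)) (trans
              (+-congʳ (trans (φ-cong (solve 3 (λ x₀ x t → x₀ :+ (x :- t) := x₀ :+ x :- t)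
                refl x₀ x t)) (affine t 0≤t t≤r)))
              (trans (solve 6 (λ v s t k x c → v :+ s :* t :- (k :* (x :- t) :+ c)
                := v :- (k :* x :+ c) :+ (s :+ k) :* t)
                        refl (φ (x₀ + x)) slope t k x c)
                (+-congʳ (sym (ψ≈ x))))) }
      ; support = λ x → let a , a∈ℤ , supp = support (x₀ + x) in
          a - k , IsInteger-+ a∈ℤ (IsInteger-neg k∈ℤ) , λ y →
          ≤-resp (+-congʳ (sym (ψ≈ x))) (sym (ψ≈ y)) (by (gap (supp (x₀ + y)))
            (solve 8 (λ v w a x₀ x y k c → w :- (v :+ a :* (x₀ :+ y :- (x₀ :+ x)))
                := w :- (k :* y :+ c) :- (v :- (k :* x :+ c) :+ (a :- k) :* (y :- x)))
              refl (φ (x₀ + x)) (φ (x₀ + y)) a x₀ x y k c))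
      }
      where open IntegralConvex φ-ic

  opaque
    -- If `A < r`, then for small `t` the term `B * t` is less than `r - A`, whatever the sign of
    -- `B`.
    slope≤ : ∀ {r A B τ} → 0# < τ → (∀ t → 0# ≤ t → t ≤ τ → r * t ≤ A * t + B * (t * t)) → r ≤ A
    slope≤ {r} {A} {B} 0<τ touch = ≮⇒≥ λ A<r →
      let δ , 0<δ , small = small-multiple B (gap< A<r)
          ε , 0<ε , ε≤τ , ε≤δ = 0<τ ≤∧≤ 0<δ
      in by< (gap< (small ε (≤-trans (neg≤0 (<⇒≤ 0<δ)) (<⇒≤ 0<ε)) ε≤δ) ⊠< 0<ε)
        (solve 4 (λ r A B ε → (r :- A :- B :* ε) :* ε := r :* ε :- (A :* ε :+ B :* (ε :* ε))) refl r A B ε)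
        (touch ε (<⇒≤ 0<ε) ε≤τ)

  module _ {φ : ℝ → ℝ} (φ-ic : IntegralConvex φ) where
    open IntegralConvex φ-ic

    opaque
      -- The supporting line at `x` does not fall towards one of the two ends, so `φ` is at least
      -- `φ x` there.
      bounded-between : ∀ {a b x v} → a ≤ x → x ≤ b → φ a ≤ v → φ b ≤ v → φ x ≤ v
      bounded-between {a} {b} {x} {v} a≤x x≤b φa≤v φb≤v =
        let k , _ , supp = support x in case total 0# k of λ
          { (inj₁ 0≤k) → by (gap φb≤v ⊞ gap (supp b) ⊞ 0≤k ⊠ gap x≤b)
              (solve 5 (λ v φb φx k d → v :- φb :+ (φb :- (φx :+ k :* d)) :+ k :* d := v :- φx)
                refl v (φ b) (φ x) k (b - x))
          ; (inj₂ k≤0) → by (gap φa≤v ⊞ gap (supp a) ⊞ gap k≤0 ⊠ gap a≤x)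
              (solve 6 (λ v φa φx k a x → v :- φa :+ (φa :- (φx :+ k :* (a :- x))) :+ (con (+ 0) :- k) :* (x :- a) := v :- φx)
                refl v (φ a) (φ x) k a x) }

      strictly-bounded-between : ∀ {a b x v} → a ≤ x → x ≤ b → φ a < v → φ b < v → φ x < v
      strictly-bounded-between a≤x x≤b φa<v φb<v =
        let m , φa≤m , φb≤m , m<v = upperBound< φa<v φb<v
        in ≤-<-trans (bounded-between a≤x x≤b φa≤m φb≤m) m<v

      below-chord : ∀ x d {t} → 0# ≤ t → t ≤ 1# → φ (x + t * d) ≤ φ x + t * (φ (x + d) - φ x)
      below-chord x d {t} 0≤t t≤1 =
        let a , _ , supp = support (x + t * d) in
        by (gap t≤1 ⊠ gap (supp x) ⊞ 0≤t ⊠ gap (supp (x + d)))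
          (solve 7 (λ x d t a u v w →
              (con (+ 1) :- t) :* (u :- (w :+ a :* (x :- (x :+ t :* d)))) :+ t :* (v :- (w :+ a :* (x :+ d :- (x :+ t :* d))))
              := u :+ t :* (v :- u) :- w) refl x d t a (φ x) (φ (x + d)) (φ (x + t * d)))

      usc : UpperSemicontinuous φ
      usc x {e} 0<e =
        let module r = Germ (right x)
            module l = Germ (left x)
            δ₁ , 0<δ₁ , r-small = small-multiple r.slope 0<e
            δ₂ , 0<δ₂ , l-small = small-multiple l.slope 0<e
            ε₁ , 0<ε₁ , ε₁≤δ₁ , ε₁≤r = 0<δ₁ ≤∧≤ r.radius>0
            ε₂ , 0<ε₂ , ε₂≤δ₂ , ε₂≤l = 0<δ₂ ≤∧≤ l.radius>0
            δ , 0<δ , δ≤ε₁ , δ≤ε₂ = 0<ε₁ ≤∧≤ 0<ε₂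
        in δ , 0<δ , λ t p q → case total x t of λ
          { (inj₁ x≤t) →
              let d≤δ = t-x≤δ q in
              <-resp (sym (trans (φ-cong (solve 2 (λ x t → t := x :+ (t :- x)) refl x t))
                            (r.affine (t - x) (gap x≤t) (≤-trans d≤δ (≤-trans δ≤ε₁ ε₁≤r))))) refl
                (+-monoˡ-< (φ x) (r-small (t - x) (≤-trans (neg≤0 (<⇒≤ 0<δ₁)) (gap x≤t)) (≤-trans d≤δ (≤-trans δ≤ε₁ ε₁≤δ₁))))
          ; (inj₂ t≤x) →
              let d≤δ = x-t≤δ p in
              <-resp (sym (trans (φ-cong (solve 2 (λ x t → t := x :- (x :- t)) refl x t))
                            (l.affine (x - t) (gap t≤x) (≤-trans d≤δ (≤-trans δ≤ε₂ ε₂≤l))))) refl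
                (+-monoˡ-< (φ x) (l-small (x - t) (≤-trans (neg≤0 (<⇒≤ 0<δ₂)) (gap t≤x)) (≤-trans d≤δ (≤-trans δ≤ε₂ ε₂≤δ₂)))) }
        where
        x-t≤δ : ∀ {δ t} → x - δ ≤ t → x - t ≤ δ
        x-t≤δ {δ} {t} p = by (gap p) (solve 3 (λ x δ t → t :- (x :- δ) := δ :- (x :- t)) refl x δ t)
        +-monoˡ-< : ∀ z {u v} → u < v → z + u < z + v
        +-monoˡ-< z {u} {v} u<v = by< (gap< u<v) (solve 3 (λ z u v → v :- u := z :+ v :- (z :+ u)) refl z u v)

      -- An integer support slope at a point where φ > 0 would be at least 1 and
      -- so make φ grow by more than h on the remaining interval.
      flat-right : ∀ {h} → φ 0# ≤ 0# → φ (h + h) < h → ∀ t → 0# ≤ t → t ≤ h → φ t ≤ 0#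
      flat-right {h} φ0≤0 φ2h<h t 0≤t t≤h = ≮⇒≥ λ 0<φt →
        let a , a∈ℤ , supp = support t
            0<a : 0# < a
            0<a = λ a≤0 → by< (gap< 0<φt ⊞< (gap (supp 0#) ⊞ gap φ0≤0 ⊞ gap a≤0 ⊠ 0≤t))
              (solve 4 (λ φt φ0 a t → φt :- con (+ 0) :+ (φ0 :- (φt :+ a :* (con (+ 0) :- t)) :+ (con (+ 0) :- φ0) :+ (con (+ 0) :- a) :* t)
                 := con (+ 0) :- con (+ 0)) refl (φ t) (φ 0#) a t) ≤-refl
            1≤a : 1# ≤ a
            1≤a = ≤-resp (+-identityʳ 1#) refl (integer-gap IsInteger-0 a∈ℤ 0<a)
        in φ2h<h (by (<⇒≤ (gap< 0<φt) ⊞ gap (supp (h + h)) ⊞ gap 1≤a ⊠ (gap t≤h ⊞ ≤-trans 0≤t t≤h) ⊞ gap t≤h)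
          (solve 5 (λ φt φh a t h → φt :- con (+ 0) :+ (φh :- (φt :+ a :* (h :+ h :- t))) :+ (a :- con (+ 1)) :* (h :- t :+ h) :+ (h :- t)
             := φh :- h) refl (φ t) (φ (h + h)) a t h))

    opaque
      -- A smooth function touching a convex function from above rules out a kink.
      touch : ∀ x {A B τ} → 0# < τ →
        (∀ t → - τ ≤ t → t ≤ τ → φ (x + t) ≤ φ x + (A * t + B * (t * t))) →
        IsInteger A × ∃ λ δ → 0# < δ × (∀ t → - δ ≤ t → t ≤ δ → φ (x + t) ≈ φ x + A * t)
      touch x {A} {B} {τ} 0<τ φ≤ =
        let module r = Germ (right x)
            module l = Germ (left x)
            a , _ , supp = support x
            τ₁ , 0<τ₁ , τ₁≤τ , τ₁≤r = 0<τ ≤∧≤ r.radius>0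
            τ₂ , 0<τ₂ , τ₂≤τ , τ₂≤l = 0<τ ≤∧≤ l.radius>0
            -- The touching function bounds the one-sided slopes from above, the support bounds them
            -- from below. The resulting chain `A ≤ - l ≤ a ≤ r ≤ A` collapses, and `A` is the
            -- integral slope `r` of the right germ.
            r≤A : r.slope ≤ A
            r≤A = slope≤ {B = B} 0<τ₁ λ t 0≤t t≤τ₁ →
              by (gap (≤-resp (r.affine t 0≤t (≤-trans t≤τ₁ τ₁≤r)) refl
                    (φ≤ t (≤-trans (neg≤0 (<⇒≤ 0<τ)) 0≤t) (≤-trans t≤τ₁ τ₁≤τ))))
                (solve 4 (λ v r t s → v :+ s :- (v :+ r :* t) := s :- r :* t)
                  refl (φ x) r.slope t (A * t + B * (t * t)))
            l≤-A : l.slope ≤ - A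
            l≤-A = slope≤ {B = B} 0<τ₂ λ t 0≤t t≤τ₂ →
              by (gap (≤-resp (l.affine t 0≤t (≤-trans t≤τ₂ τ₂≤l)) refl
                    (φ≤ (- t) (neg-mono (≤-trans t≤τ₂ τ₂≤τ)) (≤-trans (neg≤0 0≤t) (<⇒≤ 0<τ)))))
                (solve 5 (λ v l t A B → v :+ (A :* (:- t) :+ B :* (:- t :* :- t)) :- (v :+ l :* t)
                   := :- A :* t :+ B :* (t :* t) :- l :* t) refl (φ x) l.slope t A B)
            a≤r : a ≤ r.slope
            a≤r = *-cancelʳ-≤ r.radius>0 (by
              (gap (≤-resp refl (r.affine r.radius (<⇒≤ r.radius>0) ≤-refl) (supp (x + r.radius))))
              (solve 5 (λ v r s a x → v :+ r :* s :- (v :+ a :* (x :+ s :- x)) := r :* s :- a :* s)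
                refl (φ x) r.slope r.radius a x))
            -a≤l : - a ≤ l.slope
            -a≤l = *-cancelʳ-≤ l.radius>0 (by
              (gap (≤-resp refl (l.affine l.radius (<⇒≤ l.radius>0) ≤-refl) (supp (x - l.radius))))
              (solve 5 (λ v l s a x → v :+ l :* s :- (v :+ a :* (x :- s :- x)) := l :* s :- :- a :* s)
                refl (φ x) l.slope l.radius a x))
            r≈A : r.slope ≈ A
            r≈A = antisym r≤A (by (gap l≤-A ⊞ gap -a≤l ⊞ gap a≤r)
              (solve 4 (λ r l a A → :- A :- l :+ (l :- :- a) :+ (r :- a) := r :- A) refl r.slope l.slope a A))
            l≈-A : l.slope ≈ - A
            l≈-A = antisym l≤-A (by (gap r≤A ⊞ gap -a≤l ⊞ gap a≤r)
              (solve 4 (λ r l a A → A :- r :+ (l :- :- a) :+ (r :- a) := l :- :- A) refl r.slope l.slope a A))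
            δ , 0<δ , δ≤r , δ≤l = r.radius>0 ≤∧≤ l.radius>0
        in IsInteger-resp r≈A r.integral , δ , 0<δ , λ t -δ≤t t≤δ → case total 0# t of λ
          { (inj₁ 0≤t) → trans (r.affine t 0≤t (≤-trans t≤δ δ≤r)) (+-congˡ (*-congʳ r≈A))
          ; (inj₂ t≤0) → trans (φ-cong (solve 2 (λ x t → x :+ t := x :- :- t) refl x t))
              (trans (l.affine (- t) (0≤neg t≤0)
                       (≤-trans (≤-resp refl (-‿involutive δ) (neg-mono -δ≤t)) δ≤l))
                (+-congˡ (trans (*-congʳ l≈-A) (solve 2 (λ A t → :- A :* :- t := A :* t) refl A t)))) }

  -- Functions of two variables

  record SeparatelyIntegralConvex (f : ℝ → ℝ → ℝ) : Set where
    field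
      row : ∀ y → IntegralConvex (λ x → f x y)
      col : ∀ x → IntegralConvex (f x)

    f-cong : ∀ {x x′ y y′} → x ≈ x′ → y ≈ y′ → f x y ≈ f x′ y′
    f-cong {x} {x′} {y} x≈ y≈ = trans (IntegralConvex.φ-cong (row y) x≈) (IntegralConvex.φ-cong (col x′) y≈)

  opaque
    small-multiple± : ∀ s {τ} → 0# < τ →
      ∃ λ δ → 0# < δ × δ ≤ τ × (∀ t → - δ ≤ t → t ≤ δ → - τ ≤ s * t × s * t ≤ τ)
    small-multiple± s {τ} 0<τ =
      let δ₁ , 0<δ₁ , small = small-multiple s 0<τ
          δ , 0<δ , δ≤δ₁ , δ≤τ = 0<δ₁ ≤∧≤ 0<τ
      in δ , 0<δ , δ≤τ , λ t -δ≤t t≤δ →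
        let -δ₁≤t = ≤-trans (neg-mono δ≤δ₁) -δ≤t
            t≤δ₁  = ≤-trans t≤δ δ≤δ₁
        in by (<⇒≤ (gap< (small (- t) (neg-mono t≤δ₁)
                (≤-resp refl (-‿involutive δ₁) (neg-mono -δ₁≤t)))))
             (solve 3 (λ s t τ → τ :- s :* :- t := s :* t :- :- τ) refl s t τ) ,
           <⇒≤ (small t -δ₁≤t t≤δ₁)

    negate≤ : ∀ {τ t} → - τ ≤ t → - t ≤ τ
    negate≤ {τ} {t} p = by (gap p) (solve 2 (λ τ t → t :- :- τ := τ :- :- t) refl τ t)

    sep-tilt : ∀ {f g x₀ y₀ k l c} → SeparatelyIntegralConvex f → IsInteger k → IsInteger l →
      (∀ x y → g x y ≈ f (x₀ + x) (y₀ + y) - (k * x + l * y + c)) → SeparatelyIntegralConvex g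
    sep-tilt {f} {g} {x₀} {y₀} {k} {l} {c} f-sep k∈ℤ l∈ℤ g≈ = record
      { row = λ y → tilt {c = l * y + c} (row (y₀ + y)) k∈ℤ λ x → trans (g≈ x y)
          (solve 4 (λ v a b c → v :- (a :+ b :+ c) := v :- (a :+ (b :+ c)))
            refl (f (x₀ + x) (y₀ + y)) (k * x) (l * y) c)
      ; col = λ x → tilt {c = k * x + c} (col (x₀ + x)) l∈ℤ λ y → trans (g≈ x y)
          (solve 4 (λ v a b c → v :- (a :+ b :+ c) := v :- (b :+ (a :+ c)))
            refl (f (x₀ + x) (y₀ + y)) (k * x) (l * y) c)
      }
      where open SeparatelyIntegralConvex f-sep

    sep-mirror : ∀ {f} → SeparatelyIntegralConvex f → SeparatelyIntegralConvex (λ x y → f (- x) y)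
    sep-mirror f-sep = record { row = λ y → mirror (row y) ; col = λ x → col (- x) }
      where open SeparatelyIntegralConvex f-sep

  module _ {f : ℝ → ℝ → ℝ} (f-sep : SeparatelyIntegralConvex f) where
    open SeparatelyIntegralConvex f-sep

    opaque
      -- Let `h` be half of `δ`. Upper semicontinuity of the columns through `(± δ , 0)` keeps
      -- `f (± δ) u` below `h` for small `u`, and each of these rows vanishes at 0. Hence
      -- `flat-right` and its mirror image give values ≤ 0 for `t` between `- h` and `h`.
      flat-cross : ∀ {δ} → 0# < δ → f δ 0# ≈ 0# → f (- δ) 0# ≈ 0# →
        (∀ u → - δ ≤ u → u ≤ δ → f 0# u ≈ 0#) →
        ∃ λ ε → 0# < ε × (∀ t u → - ε ≤ t → t ≤ ε → - ε ≤ u → u ≤ ε → f t u ≈ 0#)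
      flat-cross {δ} 0<δ fδ≈0 f-δ≈0 f0≈0 =
        let h , 0<h , 2h≈δ = halve 0<δ
            ε₁ , 0<ε₁ , near₁ = usc (col δ) 0# 0<h
            ε₂ , 0<ε₂ , near₂ = usc (col (- δ)) 0# 0<h
            ε₃ , 0<ε₃ , ε₃≤ε₁ , ε₃≤ε₂ = 0<ε₁ ≤∧≤ 0<ε₂
            ε₄ , 0<ε₄ , ε₄≤h , ε₄≤δ = 0<h ≤∧≤ 0<δ
            ε , 0<ε , ε≤ε₃ , ε≤ε₄ = 0<ε₃ ≤∧≤ 0<ε₄
            vanish : ∀ u → - ε ≤ u → u ≤ ε → ∀ t → - ε ≤ t → t ≤ ε → f t u ≈ 0#
            vanish u -ε≤u u≤ε t -ε≤t t≤ε =
              let fu≈0 = f0≈0 u (≤-trans (neg-mono (≤-trans ε≤ε₄ ε₄≤δ)) -ε≤u) (≤-trans u≤ε (≤-trans ε≤ε₄ ε₄≤δ))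
                  bound₁ : f (h + h) u < h
                  bound₁ = <-resp (f-cong (sym 2h≈δ) refl) (trans (+-congʳ fδ≈0) (+-identityˡ h))
                    (near₁ u (lower (≤-trans ε≤ε₃ ε₃≤ε₁) -ε≤u) (upper (≤-trans ε≤ε₃ ε₃≤ε₁) u≤ε))
                  bound₂ : f (- (h + h)) u < h
                  bound₂ = <-resp (f-cong (-‿cong (sym 2h≈δ)) refl) (trans (+-congʳ f-δ≈0) (+-identityˡ h))
                    (near₂ u (lower (≤-trans ε≤ε₃ ε₃≤ε₂) -ε≤u) (upper (≤-trans ε≤ε₃ ε₃≤ε₂) u≤ε))
                  nonpos : ∀ t → - h ≤ t → t ≤ h → f t u ≤ 0#
                  nonpos t -h≤t t≤h = case total 0# t of λ
                    { (inj₁ 0≤t) → flat-right (row u) (≤-reflexive fu≈0) bound₁ t 0≤t t≤h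
                    ; (inj₂ t≤0) → ≤-resp (f-cong (-‿involutive t) refl) refl
                        (flat-right (mirror (row u)) (≤-reflexive (trans (f-cong -0#≈0# refl) fu≈0)) bound₂
                          (- t) (0≤neg t≤0) (negate≤ -h≤t)) }
                  -h≤t = ≤-trans (neg-mono (≤-trans ε≤ε₄ ε₄≤h)) -ε≤t
                  t≤h = ≤-trans t≤ε (≤-trans ε≤ε₄ ε₄≤h)
                  a , _ , supp = IntegralConvex.support (row u) 0#
              -- The support inequalities at `t` and `- t` add up to
              -- `f t u + f (- t) u ≥ 2 * f 0# u = 0`, so `f (- t) u ≤ 0` forces `f t u ≥ 0`.
              in antisym (nonpos t -h≤t t≤h)
                (by (gap (supp t) ⊞ gap (supp (- t)) ⊞ gap (nonpos (- t) (neg-mono t≤h) (negate≤ -h≤t))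
                  ⊞ (gap≈ (sym fu≈0) ⊞ gap≈ (sym fu≈0)))
                  (solve 5 (λ v w z a t → v :- (z :+ a :* (t :- con (+ 0))) :+ (w :- (z :+ a :* (:- t :- con (+ 0)))) :+ (con (+ 0) :- w)
                       :+ (z :- con (+ 0) :+ (z :- con (+ 0))) := v :- con (+ 0))
                         refl (f t u) (f (- t) u) (f 0# u) a t))
        in ε , 0<ε , λ t u p q p′ q′ → vanish u p′ q′ t p q
        where
        lower : ∀ {ε ε₁ u} → ε ≤ ε₁ → - ε ≤ u → 0# - ε₁ ≤ u
        lower {ε} {ε₁} {u} p q = by (gap p ⊞ gap q) (solve 3 (λ ε ε₁ u → ε₁ :- ε :+ (u :- :- ε)
          := u :- (con (+ 0) :- ε₁)) refl ε ε₁ u)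
        upper : ∀ {ε ε₁ u} → ε ≤ ε₁ → u ≤ ε → u ≤ 0# + ε₁
        upper p q = ≤-resp refl (sym (+-identityˡ _)) (≤-trans q p)

  module _ {f : ℝ → ℝ → ℝ} (f-sep : SeparatelyIntegralConvex f) where
    open SeparatelyIntegralConvex f-sep

    opaque
      -- Subtracting the affine function with slopes `A` and `B` reduces this to `flat-cross`; the
      -- integrality of `A` and `B` keeps the difference in the class.
      affine-near : ∀ {x y A B} → IsInteger A → IsInteger B →
        (∃ λ δ → 0# < δ × (∀ t → - δ ≤ t → t ≤ δ → f (x + t) y ≈ f x y + A * t)) →
        (∃ λ δ → 0# < δ × (∀ u → - δ ≤ u → u ≤ δ → f x (y + u) ≈ f x y + B * u)) →
        ∃ λ ε → 0# < ε × (∀ t u → - ε ≤ t → t ≤ ε → - ε ≤ u → u ≤ ε →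
          f (x + t) (y + u) ≈ f x y + (A * t + B * u))
      affine-near {x} {y} {A} {B} A∈ℤ B∈ℤ (δ₁ , 0<δ₁ , row-affine) (δ₂ , 0<δ₂ , col-affine) =
        case 0<δ₁ ≤∧≤ 0<δ₂ of λ { (δ , 0<δ , δ≤δ₁ , δ≤δ₂) →
        case flat-cross g-sep 0<δ
              (row≈0 δ (≤-trans (neg≤0 (<⇒≤ 0<δ₁)) (<⇒≤ 0<δ)) δ≤δ₁)
              (row≈0 (- δ) (neg-mono δ≤δ₁) (≤-trans (neg≤0 (<⇒≤ 0<δ)) (<⇒≤ 0<δ₁)))
              (λ u p q → col≈0 u (≤-trans (neg-mono δ≤δ₂) p) (≤-trans q δ≤δ₂))
          of λ { (ε , 0<ε , g≈0) →
        ε , 0<ε , λ t u p q p′ q′ → trans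
          (solve 2 (λ w a → w := w :- a :+ a) refl (f (x + t) (y + u)) (A * t + B * u + f x y))
          (trans (+-congʳ (g≈0 t u p q p′ q′))
            (solve 2 (λ a v → con (+ 0) :+ (a :+ v) := v :+ a) refl (A * t + B * u) (f x y))) }}
        where
        g : ℝ → ℝ → ℝ
        g t u = f (x + t) (y + u) - (A * t + B * u + f x y)
        g-sep : SeparatelyIntegralConvex g
        g-sep = sep-tilt f-sep A∈ℤ B∈ℤ λ _ _ → refl
        row≈0 : ∀ t → - δ₁ ≤ t → t ≤ δ₁ → g t 0# ≈ 0#
        row≈0 t p q = trans (+-congʳ (trans (f-cong refl (+-identityʳ y)) (row-affine t p q)))
          (solve 4 (λ v A t B → v :+ A :* t :- (A :* t :+ B :* con (+ 0) :+ v) := con (+ 0)) refl (f x y) A t B)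
        col≈0 : ∀ u → - δ₂ ≤ u → u ≤ δ₂ → g 0# u ≈ 0#
        col≈0 u p q = trans (+-congʳ (trans (f-cong (+-identityʳ x) refl) (col-affine u p q)))
          (solve 4 (λ v A u B → v :+ B :* u :- (A :* con (+ 0) :+ B :* u :+ v) := con (+ 0)) refl (f x y) A u B)

      -- The strict bound makes (x , y) the leftmost local maximum of f + κx
      -- along the line of slope s.  The touching quadratic forces f to be
      -- affine near (x , y), hence f + κx to be constant along that line.
      no-touching : ∀ x y {s κ B K τ} → 0# < τ →
        (∀ t v → - τ ≤ t → t ≤ τ → - τ ≤ v → v ≤ τ →
          f (x + t) (y + (s * t + v)) ≤ f x y + (B * v + K * (v * v) - κ * t)) →
        (∀ t → 0# < t → t ≤ τ → f (x - t) (y - s * t) < f x y + κ * t) → ⊥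
      no-touching x y {s} {κ} {B} {K} {τ} 0<τ below strict =
        case small-multiple± s 0<τ of λ { (σ , 0<σ , σ≤τ , s-small) →
        case touch (row y) x {A} {K * (s * s)} 0<σ (row-touch σ≤τ s-small) of λ { (A∈ℤ , row-affine) →
        case touch (col x) y {B} {K} 0<τ col-touch of λ { (B∈ℤ , col-affine) →
        case affine-near A∈ℤ B∈ℤ row-affine col-affine of λ { (ε , 0<ε , f-affine) →
        case small-multiple± s 0<ε of λ { (ρ , 0<ρ , ρ≤ε , s-small′) →
        case 0<ρ ≤∧≤ 0<τ of λ { (t , 0<t , t≤ρ , t≤τ) →
        case s-small′ t (≤-trans (neg≤0 (<⇒≤ 0<ρ)) (<⇒≤ 0<t)) t≤ρ of λ { (-ε≤st , st≤ε) →
        strict t 0<t t≤τ (≤-reflexive (sym (trans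
          (f-affine (- t) (- (s * t)) (neg-mono (≤-trans t≤ρ ρ≤ε)) (≤-trans (neg≤0 (<⇒≤ 0<t)) (<⇒≤ 0<ε))
            (neg-mono st≤ε) (negate≤ -ε≤st))
          (solve 5 (λ v κ B s t → v :+ ((:- κ :- B :* s) :* :- t :+ B :* :- (s :* t)) := v :+ κ :* t)
            refl (f x y) κ B s t)))) }}}}}}}
        where
        -- On the row through `(x , y)` the offset is `v = - (s * t)`, so the linear part
        -- `B * v - κ * t` of the touching function has slope `- κ - B * s`.
        A : ℝ
        A = - κ - B * s
        row-touch : ∀ {σ} → σ ≤ τ → (∀ t → - σ ≤ t → t ≤ σ → - τ ≤ s * t × s * t ≤ τ) →
          ∀ t → - σ ≤ t → t ≤ σ → f (x + t) y ≤ f x y + (A * t + K * (s * s) * (t * t))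
        row-touch σ≤τ s-small t -σ≤t t≤σ = ≤-resp
          (f-cong refl (solve 3 (λ y s t → y :+ (s :* t :+ :- (s :* t)) := y) refl y s t))
          (+-congˡ (solve 5 (λ B s t K κ → B :* :- (s :* t) :+ K :* (:- (s :* t) :* :- (s :* t)) :- κ :* t
             := (:- κ :- B :* s) :* t :+ K :* (s :* s) :* (t :* t)) refl B s t K κ))
          (below t (- (s * t)) (≤-trans (neg-mono σ≤τ) -σ≤t) (≤-trans t≤σ σ≤τ)
            (neg-mono (proj₂ (s-small t -σ≤t t≤σ))) (negate≤ (proj₁ (s-small t -σ≤t t≤σ))))
        col-touch : ∀ v → - τ ≤ v → v ≤ τ → f x (y + v) ≤ f x y + (B * v + K * (v * v))
        col-touch v -τ≤v v≤τ = ≤-resp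
          (f-cong (solve 1 (λ x → x :+ con (+ 0) := x) refl x)
            (solve 3 (λ y s v → y :+ (s :* con (+ 0) :+ v) := y :+ v) refl y s v))
          (+-congˡ (solve 4 (λ B v K κ → B :* v :+ K :* (v :* v) :- κ :* con (+ 0) := B :* v :+ K :* (v :* v))
            refl B v K κ))
          (below 0# v (neg≤0 (<⇒≤ 0<τ)) (<⇒≤ 0<τ) -τ≤v v≤τ)

  -- Existence of touching functions

  opaque
    -- Near `u` the function lies below the chords to `u + 1` and `u - 1`, and these tend to `N u`.
    -- The point `v` is kept apart from `u + t * d` because the intended `N` is built from chosen
    -- maximisers and is not known to respect `_≈_`.
    usc-belowChords : ∀ {N} →
      (∀ u v d t → 0# ≤ t → t ≤ 1# → v ≈ u + t * d → N v ≤ N u + t * (N (u + d) - N u)) →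
      UpperSemicontinuous N
    usc-belowChords {N} chord u {e} 0<e =
      case small-multiple (N (u + 1#) - N u) 0<e of λ { (δ₁ , 0<δ₁ , small₁) →
      case small-multiple (N (u + - 1#) - N u) 0<e of λ { (δ₂ , 0<δ₂ , small₂) →
      case 0<δ₁ ≤∧≤ 0<δ₂ of λ { (δ₃ , 0<δ₃ , δ₃≤δ₁ , δ₃≤δ₂) →
      case 0<δ₃ ≤∧≤ 0<1 of λ { (δ , 0<δ , δ≤δ₃ , δ≤1) →
      δ , 0<δ , λ v u-δ≤v v≤u+δ → case total u v of λ
        { (inj₁ u≤v) →
            let d≤δ = t-x≤δ v≤u+δ in
            near (v - u) _ (small₁ (v - u) (≤-trans (neg≤0 (<⇒≤ 0<δ₁)) (gap u≤v)) (≤-trans d≤δ (≤-trans δ≤δ₃ δ₃≤δ₁)))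
              (chord u v 1# (v - u) (gap u≤v) (≤-trans d≤δ δ≤1) (solve 2 (λ u v → v
                := u :+ (v :- u) :* con (+ 1)) refl u v))
        ; (inj₂ v≤u) →
            let d≤δ = ≤-resp (solve 2 (λ u v → :- (v :- u) := u :- v) refl u v) refl (negate≤ (-δ≤t-x u-δ≤v)) in
            near (u - v) _ (small₂ (u - v) (≤-trans (neg≤0 (<⇒≤ 0<δ₂)) (gap v≤u)) (≤-trans d≤δ (≤-trans δ≤δ₃ δ₃≤δ₂)))
              (chord u v (- 1#) (u - v) (gap v≤u) (≤-trans d≤δ δ≤1)
                (solve 2 (λ u v → v := u :+ (u :- v) :* (:- con (+ 1))) refl u v)) } }}}}
      where
      near : ∀ {v} t D → D * t < e → N v ≤ N u + t * D → N v < N u + e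
      near {v} t D Dt<e p = by< (gap< Dt<e ⊞< gap p)
        (solve 5 (λ e D t v w → e :- D :* t :+ (w :+ t :* D :- v) := w :+ e :- v) refl e D t (N v) (N u))

  module _ {f : ℝ → ℝ → ℝ} (f-sep : SeparatelyIntegralConvex f) where
    open SeparatelyIntegralConvex f-sep

    opaque
      -- Half of `e` is spent on the row of `y`, to bound `f` at `x - δ₁` and `x + δ₁`; the other
      -- half on the two columns there, to pass to nearby rows. Convexity of those rows fills in the
      -- points between the columns.
      usc-plane : ∀ x y {e} → 0# < e → ∃ λ δ → 0# < δ × (∀ x′ y′ →
        x - δ ≤ x′ → x′ ≤ x + δ → y - δ ≤ y′ → y′ ≤ y + δ → f x′ y′ < f x y + e)
      usc-plane x y {e} 0<e =
        case halve 0<e of λ { (h , 0<h , 2h≈e) →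
        case usc (row y) x 0<h of λ { (δ₁ , 0<δ₁ , near) →
        let x-δ₁≤x+δ₁ = ≤-trans (<⇒≤ (x-δ<x x 0<δ₁)) (<⇒≤ (x<x+δ x 0<δ₁)) in
        case usc (col (x - δ₁)) y 0<h of λ { (δ₂ , 0<δ₂ , near₂) →
        case usc (col (x + δ₁)) y 0<h of λ { (δ₃ , 0<δ₃ , near₃) →
        case 0<δ₂ ≤∧≤ 0<δ₃ of λ { (δ₄ , 0<δ₄ , δ₄≤δ₂ , δ₄≤δ₃) →
        case 0<δ₁ ≤∧≤ 0<δ₄ of λ { (δ , 0<δ , δ≤δ₁ , δ≤δ₄) →
        δ , 0<δ , λ x′ y′ p q p′ q′ →
          strictly-bounded-between (row y′) (widen- δ≤δ₁ p) (widen+ δ≤δ₁ q)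
            (combine 2h≈e (near₂ y′ (widen- (≤-trans δ≤δ₄ δ₄≤δ₂) p′) (widen+ (≤-trans δ≤δ₄ δ₄≤δ₂) q′))
              (near (x - δ₁) ≤-refl x-δ₁≤x+δ₁))
            (combine 2h≈e (near₃ y′ (widen- (≤-trans δ≤δ₄ δ₄≤δ₃) p′) (widen+ (≤-trans δ≤δ₄ δ₄≤δ₃) q′))
              (near (x + δ₁) x-δ₁≤x+δ₁ ≤-refl)) }}}}}}
        where
        combine : ∀ {h u v w} → h + h ≈ e → u < v + h → v < w + h → u < w + e
        combine {h} {u} {v} {w} 2h≈e p q = <-resp refl (+-congˡ 2h≈e) (by< (gap< p ⊞< <⇒≤ (gap< q))
          (solve 4 (λ h u v w → v :+ h :- u :+ (w :+ h :- v) := w :+ (h :+ h) :- u) refl h u v w))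

      usc-line : ∀ s {ℓ : ℝ → ℝ} → (∀ x t → ℓ t ≈ ℓ x + s * (t - x)) → UpperSemicontinuous (λ x → f x (ℓ x))
      usc-line s {ℓ} ℓ-affine x 0<e =
        case usc-plane x (ℓ x) 0<e of λ { (δ₁ , 0<δ₁ , near) →
        case small-multiple± s 0<δ₁ of λ { (δ , 0<δ , δ≤δ₁ , small) →
        δ , 0<δ , λ t p q →
          let -δ₁≤ , ≤δ₁ = small (t - x) (-δ≤t-x p) (t-x≤δ q)
              d = s * (t - x)
          in near t (ℓ t)
            (widen- δ≤δ₁ p)
            (widen+ δ≤δ₁ q)
            (≤-resp refl (sym (ℓ-affine x t)) (by (gap -δ₁≤)
              (solve 3 (λ l δ₁ d → d :- :- δ₁ := l :+ d :- (l :- δ₁)) refl (ℓ x) δ₁ d)))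
            (≤-resp (sym (ℓ-affine x t)) refl (by (gap ≤δ₁)
              (solve 3 (λ l δ₁ d → δ₁ :- d := l :+ δ₁ :- (l :+ d)) refl (ℓ x) δ₁ d))) }}

      -- Convexity along the two horizontal sides and then along the columns bounds `f` by the
      -- largest corner value.
      bounded-on-box : ∀ a b c d → ∃ λ C → ∀ x y → a ≤ x → x ≤ b → c ≤ y → y ≤ d → f x y ≤ C
      bounded-on-box a b c d =
        case upperBound (f a c) (f b c) of λ { (C₁ , p₁ , p₂) →
        case upperBound (f a d) (f b d) of λ { (C₂ , p₃ , p₄) →
        case upperBound C₁ C₂ of λ { (C , q₁ , q₂) →
        C , λ x y a≤x x≤b c≤y y≤d → bounded-between (col x) c≤y y≤d
          (bounded-between (row c) a≤x x≤b (≤-trans p₁ q₁) (≤-trans p₂ q₁))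
          (bounded-between (row d) a≤x x≤b (≤-trans p₃ q₂) (≤-trans p₄ q₂)) }}}

      bounded-on-strip : ∀ s a b c d → ∃ λ C → ∀ u x → c ≤ u → u ≤ d → a ≤ x → x ≤ b → f x (s * (x - a) + u) ≤ C
      bounded-on-strip s a b c d = case total 0# s of λ
        { (inj₁ 0≤s) → case bounded-on-box a b c (s * (b - a) + d) of λ { (C , f≤C) →
            C , λ u x c≤u u≤d a≤x x≤b → f≤C x (s * (x - a) + u) a≤x x≤b
              (by (0≤s ⊠ gap a≤x ⊞ gap c≤u)
                (solve 5 (λ s x a u c → s :* (x :- a) :+ (u :- c) := s :* (x :- a) :+ u :- c) refl s x a u c))
              (by (0≤s ⊠ gap x≤b ⊞ gap u≤d)
                (solve 6 (λ s x a b u d → s :* (b :- x) :+ (d :- u)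
                  := s :* (b :- a) :+ d :- (s :* (x :- a) :+ u)) refl s x a b u d)) }
        ; (inj₂ s≤0) → case bounded-on-box a b (s * (b - a) + c) d of λ { (C , f≤C) →
            C , λ u x c≤u u≤d a≤x x≤b → f≤C x (s * (x - a) + u) a≤x x≤b
              (by (gap s≤0 ⊠ gap x≤b ⊞ gap c≤u)
                (solve 6 (λ s x a b u c → (con (+ 0) :- s) :* (b :- x) :+ (u :- c)
                  := s :* (x :- a) :+ u :- (s :* (b :- a) :+ c)) refl s x a b u c))
              (by (gap s≤0 ⊠ gap a≤x ⊞ gap u≤d)
                (solve 5 (λ s x a u d → (con (+ 0) :- s) :* (x :- a) :+ (d :- u) := d :- (s :* (x :- a) :+ u))
                  refl s x a u d)) } }

    -- A violation of convexity along a segment of slope `s` over `[a, b]`: `f + κ x` is negative at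
    -- both ends, even after vertical shifts `u` of size at most `w`, yet nonnegative where the
    -- segment crosses the column `x = 0`. The function `g u` is `f + κ x` on the segment shifted by
    -- `u`.
    module _ (0≤f0 : ∀ y → 0# ≤ f 0# y) {a b s κ w : ℝ} (a<0 : a < 0#) (0<b : 0# < b) (0<w : 0# < w)
             (left-end : ∀ u → - w ≤ u → u ≤ w → f a u + κ * a < 0#)
             (right-end : ∀ u → - w ≤ u → u ≤ w → f b (s * (b - a) + u) + κ * b < 0#) where
      private
        g : ℝ → ℝ → ℝ
        g u x = f x (s * (x - a) + u) + κ * x

        a≤b : a ≤ b
        a≤b = ≤-trans (<⇒≤ a<0) (<⇒≤ 0<b)

        opaque
          g-bounded : 0# ≤ κ → ∀ c d → ∃ λ C → ∀ u x → c ≤ u → u ≤ d → a ≤ x → x ≤ b → g u x ≤ C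
          g-bounded 0≤κ c d = case bounded-on-strip s a b c d of λ { (C , f≤C) →
            C + κ * b , λ u x c≤u u≤d a≤x x≤b → by (gap (f≤C u x c≤u u≤d a≤x x≤b) ⊞ 0≤κ ⊠ gap x≤b)
              (solve 5 (λ C v κ b x → C :- v :+ κ :* (b :- x) := C :+ κ :* b :- (v :+ κ :* x)) refl
                C (f x (s * (x - a) + u)) κ b x) }

          peak : 0# ≤ κ → ∀ u → ∃ λ x → a ≤ x × x ≤ b ×
            (∀ t → a ≤ t → t ≤ b → g u t ≤ g u x) × (∀ t → a ≤ t → t < x → g u t < g u x)
          peak 0≤κ u = case g-bounded 0≤κ u u of λ { (C , g≤C) →
            leftmostMaximum {C = C} a≤b
              (usc-+ (usc-line s λ x t → solve 5 (λ s x t a u → s :* (t :- a) :+ u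
                := s :* (x :- a) :+ u :+ s :* (t :- x)) refl s x t a u)
                (usc-linear κ))
              (λ x a≤x x≤b → g≤C u x ≤-refl ≤-refl a≤x x≤b) }

        module Peaks (0≤κ : 0# ≤ κ) where
          argmax N : ℝ → ℝ
          argmax u = proj₁ (peak 0≤κ u)
          N u = g u (argmax u)

          opaque
            a≤argmax : ∀ u → a ≤ argmax u
            a≤argmax u = proj₁ (proj₂ (peak 0≤κ u))
            argmax≤b : ∀ u → argmax u ≤ b
            argmax≤b u = proj₁ (proj₂ (proj₂ (peak 0≤κ u)))
            g≤N : ∀ u {t} → a ≤ t → t ≤ b → g u t ≤ N u
            g≤N u {t} = proj₁ (proj₂ (proj₂ (proj₂ (peak 0≤κ u)))) t
            g<N : ∀ u {t} → a ≤ t → t < argmax u → g u t < N u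
            g<N u {t} = proj₂ (proj₂ (proj₂ (proj₂ (peak 0≤κ u)))) t

            0≤N : ∀ u → 0# ≤ N u
            0≤N u = ≤-trans (≤-resp refl (solve 2 (λ v κ → v := v :+ κ :* con (+ 0))
              refl (f 0# (s * (0# - a) + u)) κ) (0≤f0 _))
              (g≤N u (<⇒≤ a<0) (<⇒≤ 0<b))

            -- A maximum of functions convex in `u` is convex: at the maximiser `x` for `v`, the
            -- column through `x` is convex, and its values for `u` and `u + d` are at most `N u`
            -- and `N (u + d)`.
            N-chord : ∀ u v d t → 0# ≤ t → t ≤ 1# → v ≈ u + t * d → N v ≤ N u + t * (N (u + d) - N u)
            N-chord u v d t 0≤t t≤1 v≈ = ≤-resp (+-congʳ (f-cong refl v-line)) refl
              (by (gap t≤1 ⊠ gap (g≤N u a≤x x≤b) ⊞ 0≤t ⊠ gap (≤-resp (+-congʳ (f-cong refl d-line))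
                refl (g≤N (u + d) a≤x x≤b))
                    ⊞ gap (below-chord (col x) y d 0≤t t≤1))
                (solve 7 (λ t Nu Nd f₀ f₁ f₂ k →
                    (con (+ 1) :- t) :* (Nu :- (f₀ :+ k)) :+ t :* (Nd :- (f₁ :+ k)) :+ (f₀ :+ t :* (f₁ :- f₀) :- f₂)
                    := Nu :+ t :* (Nd :- Nu) :- (f₂ :+ k))
                  refl t (N u) (N (u + d)) (f x y) (f x (y + d)) (f x (y + t * d)) (κ * x)))
              where
              x y : ℝ
              x = argmax v
              y = s * (x - a) + u
              a≤x : a ≤ x
              a≤x = a≤argmax v
              x≤b : x ≤ b
              x≤b = argmax≤b v
              v-line : y + t * d ≈ s * (x - a) + v
              v-line = trans (solve 3 (λ l u d → l :+ u :+ d := l :+ (u :+ d))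
                refl (s * (x - a)) u (t * d)) (+-congˡ (sym v≈))
              d-line : s * (x - a) + (u + d) ≈ y + d
              d-line = solve 3 (λ l u d → l :+ (u :+ d) := l :+ u :+ d) refl (s * (x - a)) u d

            argmax>a : ∀ {u} → - w ≤ u → u ≤ w → a < argmax u
            argmax>a {u} -w≤u u≤w x≤a = left-end u -w≤u u≤w (≤-resp refl
              (+-cong (f-cong x≈a (trans (+-congʳ (*-congˡ (+-congʳ x≈a)))
                (solve 3 (λ s a u → s :* (a :- a) :+ u := u) refl s a u))) (*-congˡ x≈a)) (0≤N u))
              where
              x≈a : argmax u ≈ a
              x≈a = antisym x≤a (a≤argmax u)

            argmax<b : ∀ {u} → - w ≤ u → u ≤ w → argmax u < b
            argmax<b {u} -w≤u u≤w b≤x = right-end u -w≤u u≤w (≤-resp refl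
              (+-cong (f-cong x≈b (+-congʳ (*-congˡ (+-congʳ x≈b)))) (*-congˡ x≈b)) (0≤N u))
              where
              x≈b : argmax u ≈ b
              x≈b = antisym (argmax≤b u) b≤x

            -- This is the situation of `no-touching`. Expanding `K * (u + v)²` around `u` gives the
            -- coefficients `2 * K * u` and `K` of the touching quadratic. The maximiser lies
            -- strictly between `a` and `b`, which leaves room for a box around the point, and being
            -- leftmost it gives the strict inequality.
            no-interior-peak : ∀ {u K} → - w < u → u < w →
              (∀ v → - w ≤ v → v ≤ w → N v + - (K * (v * v)) ≤ N u + - (K * (u * u))) → ⊥
            no-interior-peak {u} {K} -w<u u<w maximal =
              case gap< (argmax>a (<⇒≤ -w<u) (<⇒≤ u<w)) ≤∧≤ gap< (argmax<b (<⇒≤ -w<u) (<⇒≤ u<w)) of λ { (τ₁ , 0<τ₁ , τ₁≤x-a , τ₁≤b-x) →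
              case gap< -w<u ≤∧≤ gap< u<w of λ { (τ₂ , 0<τ₂ , τ₂≤u+w , τ₂≤w-u) →
              case 0<τ₁ ≤∧≤ 0<τ₂ of λ { (τ , 0<τ , τ≤τ₁ , τ≤τ₂) →
              no-touching f-sep x y {s} {κ} {K * u + K * u} {K} {τ} 0<τ
                (λ t v -τ≤t t≤τ -τ≤v v≤τ →
                  by (gap (g≤N (u + v) {x + t}
                        (by (gap -τ≤t ⊞ gap (≤-trans τ≤τ₁ τ₁≤x-a))
                          (solve 4 (λ x t τ a → t :- :- τ :+ (x :- a :- τ) := x :+ t :- a) refl x t τ a))
                        (by (gap t≤τ ⊞ gap (≤-trans τ≤τ₁ τ₁≤b-x)) (solve 4 (λ x t τ b → τ :- t :+ (b :- x :- τ)
                          := b :- (x :+ t)) refl x t τ b)))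
                      ⊞ gap (maximal (u + v)
                        (by (gap -τ≤v ⊞ gap (≤-trans τ≤τ₂ τ₂≤u+w))
                          (solve 4 (λ u v τ w → v :- :- τ :+ (u :- :- w :- τ) := u :+ v :- :- w) refl u v τ w))
                        (by (gap v≤τ ⊞ gap (≤-trans τ≤τ₂ τ₂≤w-u)) (solve 4 (λ u v τ w → τ :- v :+ (w :- u :- τ)
                          := w :- (u :+ v)) refl u v τ w)))
                      ⊞ gap≈ (f-cong refl (solve 6 (λ s x a u t v → s :* (x :- a) :+ u :+ (s :* t :+ v)
                        := s :* (x :+ t :- a) :+ (u :+ v)) refl s x a u t v)))
                    (solve 10 (λ Nv F F′ p κ x t K u v →
                       Nv :- (F :+ κ :* (x :+ t)) :+ (p :+ κ :* x :+ :- (K :* (u :* u)) :- (Nv :+ :- (K :* ((u :+ v) :* (u :+ v))))) :+ (F :- F′)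
                       := p :+ ((K :* u :+ K :* u) :* v :+ K :* (v :* v) :- κ :* t) :- F′)
                      refl (N (u + v)) (f (x + t) (s * (x + t - a) + (u + v))) (f (x + t) (y + (s * t + v))) (f x y) κ x t K u v))
                (λ t 0<t t≤τ → by< (gap< (<-resp (+-congʳ (f-cong refl
                      (solve 5 (λ s x a u t → s :* (x :- t :- a) :+ u := s :* (x :- a) :+ u :- s :* t)
                        refl s x a u t))) refl
                    (g<N u {x - t}
                      (by (gap (≤-trans t≤τ (≤-trans τ≤τ₁ τ₁≤x-a))) (solve 3 (λ x t a → x :- a :- t
                        := x :- t :- a) refl x t a))
                      (x-δ<x x 0<t))))
                  (solve 5 (λ p F κ x t → p :+ κ :* x :- (F :+ κ :* (x :- t)) := p :+ κ :* t :- F) refl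
                    (f x y) (f (x - t) (y - s * t)) κ x t)) }}}
              where
              x y : ℝ
              x = argmax u
              y = s * (x - a) + u

      opaque
        -- Maximise f + κx − Ku² over the strip of half-width w around the segment,
        -- where u is the vertical offset from the segment and K makes the boundary
        -- values too small to be maximal.
        no-negative-ends : 0# ≤ κ → ⊥
        no-negative-ends 0≤κ =
          case g-bounded 0≤κ (- w) w of λ { (C , g≤C) →
          let N≤C : ∀ u → - w ≤ u → u ≤ w → N u ≤ C
              N≤C u p q = g≤C u (argmax u) p q (a≤argmax u) (argmax≤b u)
              -w≤0 = neg≤0 (<⇒≤ 0<w)
              0≤C = ≤-trans (0≤N 0#) (N≤C 0# -w≤0 (<⇒≤ 0<w))
          in
          case reciprocal (0<w ⊠< 0<w) of λ { (i , 0<i , wwi≈1) →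
          -- Chosen so that `K * (w * w)` is `1# + C`: as `N` lies between 0 and `C` on the strip,
          -- the penalty at `u = ± w` outweighs every gain over `u = 0`.
          let K = (1# + C) * i
              0≤K = (0≤1 ⊞ 0≤C) ⊠ <⇒≤ 0<i
              Kww≈ : K * (w * w) ≈ 1# + C
              Kww≈ = trans (solve 3 (λ c i w → c :* i :* (w :* w) := c :* (w :* w :* i)) refl (1# + C) i w)
                (trans (*-congˡ wwi≈1) (*-identityʳ _))
          in
          case leftmostMaximum {λ u → N u + - (K * (u * u))} {C = C} (≤-trans -w≤0 (<⇒≤ 0<w))
                 (usc-+ {N} {λ u → - (K * (u * u))} (usc-belowChords N-chord) (usc-concaveQuadratic 0≤K))
                 (λ u p q → by (gap (N≤C u p q) ⊞ 0≤K ⊠ square u)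
                   (solve 4 (λ C n K u → C :- n :+ K :* (u :* u) := C :- (n :+ :- (K :* (u :* u))))
                     refl C (N u) K u))
            of λ { (u , -w≤u , u≤w , maximal , _) →
          let Kuu<Kww : K * (u * u) < 1# + C
              Kuu<Kww = by< (0<1 ⊞< (gap (maximal 0# -w≤0 (<⇒≤ 0<w)) ⊞ 0≤N 0# ⊞ gap (N≤C u -w≤u u≤w)))
                (solve 5 (λ K u C n m → con (+ 1) :+ (n :+ :- (K :* (u :* u)) :- (m :+ :- (K :* (con (+ 0) :* con (+ 0)))) :+ m :+ (C :- n))
                  := con (+ 1) :+ C :- K :* (u :* u)) refl K u C (N u) (N 0#))
          in no-interior-peak
            (λ u≤-w → Kuu<Kww (≤-resp Kww≈ refl (by (0≤K ⊠ (gap u≤-w ⊠ (gap u≤-w ⊞ (<⇒≤ 0<w ⊞ <⇒≤ 0<w))))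
              (solve 3 (λ K u w → K :* ((:- w :- u) :* (:- w :- u :+ (w :+ w)))
                := K :* (u :* u) :- K :* (w :* w)) refl K u w))))
            (λ w≤u → Kuu<Kww (≤-resp Kww≈ refl (by (0≤K ⊠ (gap w≤u ⊠ (gap w≤u ⊞ (<⇒≤ 0<w ⊞ <⇒≤ 0<w))))
              (solve 3 (λ K u w → K :* ((u :- w) :* (u :- w :+ (w :+ w))) := K :* (u :* u) :- K :* (w :* w))
                refl K u w))))
            maximal }}}
          where open Peaks 0≤κ

  -- Supporting planes

  opaque
    -- Suppose `f b y < 0` and take the segment from `(a , 0)` to `(b , y)`. Adding `κ * x` with
    -- small `κ > 0` makes the left end strictly negative, keeps the right end negative, and changes
    -- nothing on the column `x = 0`. Upper semicontinuity extends both signs to nearby parallel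
    -- segments, and `no-negative-ends` applies.
    nonneg-right : ∀ {f a} → SeparatelyIntegralConvex f → (∀ y → 0# ≤ f 0# y) → a < 0# → f a 0# ≤ 0# →
                   ∀ b → 0# < b → ∀ y → 0# ≤ f b y
    nonneg-right {f} {a} f-sep 0≤f0 a<0 fa≤0 b 0<b y = ≮⇒≥ λ fby<0 →
      case reciprocal {b - a} (by< (0<b ⊞< <⇒≤ (gap< a<0)) (solve 2 (λ a b → b :+ (con (+ 0) :- a)
        := b :- a :- con (+ 0)) refl a b))
        of λ { (i , _ , [b-a]i≈1) →
      case small-multiple b (gap< fby<0) of λ { (κ , 0<κ , small) →
      let bκ< = small κ (≤-trans (neg≤0 (<⇒≤ 0<κ)) (<⇒≤ 0<κ)) ≤-refl
          s[b-a]≈y : y * i * (b - a) ≈ y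
          s[b-a]≈y = trans (solve 3 (λ y i d → y :* i :* d := y :* (d :* i)) refl y i (b - a))
            (trans (*-congˡ [b-a]i≈1) (*-identityʳ _))
      in
      case usc (col b) y (gap< bκ<) of λ { (w₁ , 0<w₁ , near₁) →
      case usc (col a) 0# (gap< a<0 ⊠< 0<κ) of λ { (w₂ , 0<w₂ , near₂) →
      case 0<w₁ ≤∧≤ 0<w₂ of λ { (w , 0<w , w≤w₁ , w≤w₂) →
      no-negative-ends f-sep 0≤f0 {a} {b} {y * i} {κ} {w} a<0 0<b 0<w
        (λ u -w≤u u≤w → by< (gap< (near₂ u
              (by (gap -w≤u ⊞ gap w≤w₂) (solve 3 (λ u w v → u :- :- w :+ (v :- w) := u :- (con (+ 0) :- v))
                refl u w w₂))
              (by (gap u≤w ⊞ gap w≤w₂) (solve 3 (λ u w v → w :- u :+ (v :- w) := con (+ 0) :+ v :- u)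
                refl u w w₂)))
            ⊞< gap fa≤0)
          (solve 4 (λ f₀ fu a κ → f₀ :+ (con (+ 0) :- a) :* κ :- fu :+ (con (+ 0) :- f₀)
            := con (+ 0) :- (fu :+ κ :* a))
            refl (f a 0#) (f a u) a κ))
        (λ u -w≤u u≤w → by< (gap< (near₁ (y * i * (b - a) + u)
              (by (gap -w≤u ⊞ gap w≤w₁ ⊞ gap≈ (sym s[b-a]≈y))
                (solve 5 (λ u w v y z → u :- :- w :+ (v :- w) :+ (z :- y) := z :+ u :- (y :- v))
                refl u w w₁ y (y * i * (b - a))))
              (by (gap u≤w ⊞ gap w≤w₁ ⊞ gap≈ s[b-a]≈y) (solve 5 (λ u w v y z → w :- u :+ (v :- w) :+ (y :- z)
                := y :+ v :- (z :+ u)) refl u w w₁ y (y * i * (b - a))))))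
          (solve 4 (λ f₀ fu b κ → f₀ :+ (con (+ 0) :- f₀ :- b :* κ) :- fu := con (+ 0) :- (fu :+ κ :* b))
            refl (f b y) (f b (y * i * (b - a) + u)) b κ))
        (<⇒≤ 0<κ) }}}}}
      where open SeparatelyIntegralConvex f-sep

  IsSupport : (ℝ → ℝ → ℝ) → ℝ → ℝ → ℝ → ℝ → Set
  IsSupport f x₀ y₀ a₁ a₂ = ∀ x y → f x₀ y₀ + (a₁ * (x - x₀) + a₂ * (y - y₀)) ≤ f x y

  opaque
    -- The support is taken at a point (x₁ , y₀) slightly to the right of
    -- (x₀ , y₀), where the row has no kink.
    integral-support : ∀ {f} → SeparatelyIntegralConvex f → ∀ x₀ y₀ →
      ∃₂ λ a₁ a₂ → IsInteger a₁ × IsInteger a₂ × IsSupport f x₀ y₀ a₁ a₂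
    integral-support {f} f-sep x₀ y₀ =
      case halve radius>0 of λ { (η , 0<η , 2η≈radius) →
      case support (col (x₀ + η)) y₀ of λ { (l , l∈ℤ , l-supp) →
      slope , l , integral , l∈ℤ , is-support η 0<η 2η≈radius l l∈ℤ l-supp }}
      where
      open SeparatelyIntegralConvex f-sep
      open IntegralConvex using (support)
      open Germ (IntegralConvex.right (row y₀) x₀)
      module _ (η : ℝ) (0<η : 0# < η) (2η≈radius : η + η ≈ radius) (l : ℝ) (l∈ℤ : IsInteger l)
               (l-supp : ∀ y → f (x₀ + η) y₀ + l * (y - y₀) ≤ f (x₀ + η) y) where
        x₁ v : ℝ
        x₁ = x₀ + η
        v = f x₀ y₀
        g : ℝ → ℝ → ℝ
        g x y = f (x₁ + x) (y₀ + y) - (slope * x + l * y + f x₁ y₀)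
        g-sep : SeparatelyIntegralConvex g
        g-sep = sep-tilt f-sep integral l∈ℤ λ _ _ → refl
        η≤radius : η ≤ radius
        η≤radius = by (<⇒≤ 0<η ⊞ gap≈ 2η≈radius) (solve 2 (λ η r → η :+ (r :- (η :+ η)) := r :- η)
          refl η radius)
        fx₁≈ : f x₁ y₀ ≈ v + slope * η
        fx₁≈ = affine η (<⇒≤ 0<η) η≤radius
        0≤g0 : ∀ y → 0# ≤ g 0# y
        0≤g0 y = by (gap (l-supp (y₀ + y)) ⊞ gap≈ (f-cong (sym (+-identityʳ x₁)) (refl {y₀ + y})))
          (solve 7 (λ w w′ z l y y₀ s → w :- (z :+ l :* (y₀ :+ y :- y₀)) :+ (w′ :- w)
            := w′ :- (s :* con (+ 0) :+ l :* y :+ z) :- con (+ 0))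
             refl (f x₁ (y₀ + y)) (f (x₁ + 0#) (y₀ + y)) (f x₁ y₀) l y y₀ slope)
        -- The row of `y₀` is affine over a stretch with midpoint `x₁`, so `g` vanishes at
        -- `(± η , 0)`. Each of the two points serves `nonneg-right` for the half-plane opposite to
        -- it.
        g-η≤0 : g (- η) 0# ≤ 0#
        g-η≤0 = ≤-reflexive (trans (+-cong (f-cong (solve 2 (λ x η → x :+ η :- η := x)
          refl x₀ η) (+-identityʳ y₀)) (-‿cong (+-congˡ fx₁≈)))
          (solve 4 (λ v s η l → v :- (s :* :- η :+ l :* con (+ 0) :+ (v :+ s :* η)) := con (+ 0))
            refl v slope η l))
        gη≤0 : g (- - η) 0# ≤ 0#
        gη≤0 = ≤-reflexive (trans (+-cong (trans (f-cong (solve 2 (λ x η → x :+ η :- :- η := x :+ (η :+ η))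
          refl x₀ η) (+-identityʳ y₀))
              (affine (η + η) (<⇒≤ 0<η ⊞ <⇒≤ 0<η) (≤-reflexive 2η≈radius))) (-‿cong (+-congˡ fx₁≈)))
          (solve 4 (λ v s η l → v :+ s :* (η :+ η) :- (s :* :- :- η :+ l :* con (+ 0) :+ (v :+ s :* η))
            := con (+ 0)) refl v slope η l))
        -η<0 : - η < 0#
        -η<0 = by< 0<η (solve 1 (λ η → η := con (+ 0) :- :- η) refl η)
        g-cong : ∀ {x x′ y} → x ≈ x′ → g x y ≈ g x′ y
        g-cong x≈ = SeparatelyIntegralConvex.f-cong g-sep x≈ refl
        0≤g : ∀ x y → 0# ≤ g x y
        0≤g x y = case ≤-<-connex x 0# of λ
          { (inj₂ 0<x) → nonneg-right g-sep 0≤g0 -η<0 g-η≤0 x 0<x y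
          ; (inj₁ x≤0) → case ≤-<-connex 0# x of λ
              { (inj₁ 0≤x) → ≤-resp refl (g-cong (antisym 0≤x x≤0)) (0≤g0 y)
              ; (inj₂ x<0) → ≤-resp refl (g-cong (-‿involutive x))
                  (nonneg-right (sep-mirror g-sep) (λ y → ≤-resp refl (g-cong (sym -0#≈0#)) (0≤g0 y))
                    -η<0 gη≤0 (- x) (by< (gap< x<0) (solve 1 (λ x → con (+ 0) :- x := :- x :- con (+ 0))
                      refl x)) y) } }
        -- The plane found at `(x₁ , y₀)` also meets the graph over `(x₀ , y₀)`, because the row has
        -- slope `slope` between the two points.
        is-support : IsSupport f x₀ y₀ slope l
        is-support x y = by (0≤g (x - x₁) (y - y₀)
            ⊞ gap≈ (f-cong (solve 2 (λ x x₁ → x₁ :+ (x :- x₁) := x) refl x x₁)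
              (solve 2 (λ y y₀ → y₀ :+ (y :- y₀) := y) refl y y₀))
            ⊞ gap≈ (sym fx₁≈))
          (solve 10 (λ w w′ z v s x x₀ η l y → w :- (s :* (x :- (x₀ :+ η)) :+ l :* y :+ z) :+ (w′ :- w) :+ (z :- (v :+ s :* η))
              := w′ :- (v :+ (s :* (x :- x₀) :+ l :* y)))
            refl (f (x₁ + (x - x₁)) (y₀ + (y - y₀))) (f x y) (f x₁ y₀) v slope x x₀ η l (y - y₀))

  -- Maxima of affine functions on a line

  IsMax : ℝ → ℝ → ℝ → Set
  IsMax a b c = (c ≈ a × b ≤ a) ⊎ (c ≈ b × a ≤ b)

  opaque
    germ-dominated : ∀ {ω ω′ ω″ : ℝ → ℝ} {v v″} → (∀ t → IsMax (ω t) (ω′ t) (ω″ t)) → Germ ω v → v″ ≈ v →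
      (∃ λ δ → 0# < δ × (∀ t → 0# ≤ t → t ≤ δ → ω′ t ≤ ω t)) → Germ ω″ v″
    germ-dominated ω″-max γ v″≈v (δ , 0<δ , ω′≤ω) = case radius>0 ≤∧≤ 0<δ of λ { (ρ , 0<ρ , ρ≤radius , ρ≤δ) → record
      { slope = slope ; integral = integral ; radius = ρ ; radius>0 = 0<ρ
      ; affine = λ t 0≤t t≤ρ → trans
          (case ω″-max t of λ
            { (inj₁ (ω″≈ω , _))     → ω″≈ω
            ; (inj₂ (ω″≈ω′ , ω≤ω′)) → trans ω″≈ω′ (antisym (ω′≤ω t 0≤t (≤-trans t≤ρ ρ≤δ)) ω≤ω′) })
          (trans (affine t 0≤t (≤-trans t≤ρ ρ≤radius)) (+-congʳ (sym v″≈v))) } }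
      where open Germ γ

    -- Value and slope decide lexicographically: a strict gap between the values outlasts any
    -- difference of slopes for a short while.
    germ-≤ : ∀ {ω ω′ v v′} (γ : Germ ω v) (γ′ : Germ ω′ v′) →
      (v′ < v) ⊎ (v′ ≤ v × Germ.slope γ′ ≤ Germ.slope γ) →
      ∃ λ δ → 0# < δ × (∀ t → 0# ≤ t → t ≤ δ → ω′ t ≤ ω t)
    germ-≤ {ω} {ω′} {v} {v′} γ γ′ cmp =
      case γ.radius>0 ≤∧≤ γ′.radius>0 of λ { (ρ , 0<ρ , ρ≤ , ρ≤′) → case cmp of λ
        { (inj₂ (v′≤v , s′≤s)) → ρ , 0<ρ , λ t 0≤t t≤ρ →
            ≤-resp (sym (γ′.affine t 0≤t (≤-trans t≤ρ ρ≤′))) (sym (γ.affine t 0≤t (≤-trans t≤ρ ρ≤)))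
              (by (gap v′≤v ⊞ gap s′≤s ⊠ 0≤t)
                (solve 5 (λ v v′ s s′ t → v :- v′ :+ (s :- s′) :* t := v :+ s :* t :- (v′ :+ s′ :* t))
                  refl v v′ γ.slope γ′.slope t))
        ; (inj₁ v′<v) → case small-multiple (γ′.slope - γ.slope) (gap< v′<v) of λ { (δ₁ , 0<δ₁ , small) →
            case 0<ρ ≤∧≤ 0<δ₁ of λ { (δ , 0<δ , δ≤ρ , δ≤δ₁) → δ , 0<δ , λ t 0≤t t≤δ →
            ≤-resp (sym (γ′.affine t 0≤t (≤-trans t≤δ (≤-trans δ≤ρ ρ≤′)))) (sym (γ.affine t 0≤t (≤-trans t≤δ (≤-trans δ≤ρ ρ≤))))
              (by (<⇒≤ (gap< (small t (≤-trans (neg≤0 (<⇒≤ 0<δ₁)) 0≤t) (≤-trans t≤δ δ≤δ₁))))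
                (solve 5 (λ v v′ s s′ t → v :- v′ :- (s′ :- s) :* t := v :+ s :* t :- (v′ :+ s′ :* t))
                  refl v v′ γ.slope γ′.slope t)) }} } }
      where
      module γ = Germ γ
      module γ′ = Germ γ′

    IsMax-swap : ∀ {a b c} → IsMax a b c → IsMax b a c
    IsMax-swap (inj₁ p) = inj₂ p
    IsMax-swap (inj₂ p) = inj₁ p

    germ-max : ∀ {ω ω′ ω″ : ℝ → ℝ} {v v′ v″} → (∀ t → IsMax (ω t) (ω′ t) (ω″ t)) → IsMax v v′ v″ →
      Germ ω v → Germ ω′ v′ → Germ ω″ v″
    germ-max {v = v} {v′} {v″} ω-max v-max γ γ′ = case ≤-<-connex v v′ of λ
      { (inj₂ v′<v) → germ-dominated ω-max γ (v″≈v (<⇒≤ v′<v)) (germ-≤ γ γ′ (inj₁ v′<v))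
      ; (inj₁ v≤v′) → case ≤-<-connex v′ v of λ
          { (inj₂ v<v′) → germ-dominated (λ t → IsMax-swap (ω-max t)) γ′ (v″≈v′ v≤v′) (germ-≤ γ′ γ (inj₁ v<v′))
          ; (inj₁ v′≤v) → case total (Germ.slope γ) (Germ.slope γ′) of λ
              { (inj₁ s≤s′) → germ-dominated (λ t → IsMax-swap (ω-max t)) γ′ (v″≈v′ v≤v′) (germ-≤ γ′ γ (inj₂ (v≤v′ , s≤s′)))
              ; (inj₂ s′≤s) → germ-dominated ω-max γ (v″≈v v′≤v) (germ-≤ γ γ′ (inj₂ (v′≤v , s′≤s))) } } }
      where
      v″≈v : v′ ≤ v → v″ ≈ v
      v″≈v v′≤v = case v-max of λ
        { (inj₁ (v″≈v , _)) → v″≈v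
        ; (inj₂ (v″≈v′ , v≤v′)) → trans v″≈v′ (antisym v′≤v v≤v′) }
      v″≈v′ : v ≤ v′ → v″ ≈ v′
      v″≈v′ v≤v′ = case v-max of λ
        { (inj₁ (v″≈v , v′≤v)) → trans v″≈v (antisym v≤v′ v′≤v)
        ; (inj₂ (v″≈v′ , _)) → v″≈v′ }

  -- A notion closed under binary maxima. The slope of the support is left arbitrary, because
  -- `integralConvex` takes that of the right germ instead.
  record LocallyMaxAffine (ψ : ℝ → ℝ) : Set where
    field
      right   : ∀ x → Germ (λ t → ψ (x + t)) (ψ x)
      left    : ∀ x → Germ (λ t → ψ (x - t)) (ψ x)
      support : ∀ x → ∃ λ a → ∀ y → ψ x + a * (y - x) ≤ ψ y

  opaque
    affine⇒locallyMaxAffine : ∀ {ψ : ℝ → ℝ} {k} → IsInteger k → (∀ x t → ψ t ≈ ψ x + k * (t - x)) → LocallyMaxAffine ψ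
    affine⇒locallyMaxAffine {ψ} {k} k∈ℤ ψ-affine = record
      { right   = λ x → record { slope = k ; integral = k∈ℤ ; radius = 1# ; radius>0 = 0<1
          ; affine = λ t _ _ → trans (ψ-affine x (x + t)) (+-congˡ (solve 3 (λ k x t → k :* (x :+ t :- x)
              := k :* t) refl k x t)) }
      ; left    = λ x → record { slope = - k ; integral = IsInteger-neg k∈ℤ ; radius = 1# ; radius>0 = 0<1
          ; affine = λ t _ _ → trans (ψ-affine x (x - t)) (+-congˡ (solve 3 (λ k x t → k :* (x :- t :- x)
              := :- k :* t) refl k x t)) }
      ; support = λ x → k , λ y → ≤-reflexive (sym (ψ-affine x y))
      }

    max⇒locallyMaxAffine : ∀ {ψ ψ′ ψ″ : ℝ → ℝ} → (∀ x → IsMax (ψ x) (ψ′ x) (ψ″ x)) →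
      LocallyMaxAffine ψ → LocallyMaxAffine ψ′ → LocallyMaxAffine ψ″
    max⇒locallyMaxAffine {ψ} {ψ′} {ψ″} ψ-max p p′ = record
      { right   = λ x → germ-max (λ t → ψ-max (x + t)) (ψ-max x) (P.right x) (P′.right x)
      ; left    = λ x → germ-max (λ t → ψ-max (x - t)) (ψ-max x) (P.left x) (P′.left x)
      ; support = λ x → case ψ-max x of λ
          { (inj₁ (ψ″≈ψ , _))  → proj₁ (P.support x) , λ y →
              ≤-trans (≤-resp (+-congʳ (sym ψ″≈ψ)) refl (proj₂ (P.support x) y)) (≤ψ″ y)
          ; (inj₂ (ψ″≈ψ′ , _)) → proj₁ (P′.support x) , λ y →
              ≤-trans (≤-resp (+-congʳ (sym ψ″≈ψ′)) refl (proj₂ (P′.support x) y)) (≤ψ″′ y) }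
      }
      where
      module P = LocallyMaxAffine p
      module P′ = LocallyMaxAffine p′
      ≤ψ″ : ∀ y → ψ y ≤ ψ″ y
      ≤ψ″ y = case ψ-max y of λ
        { (inj₁ (ψ″≈ , _)) → ≤-reflexive (sym ψ″≈) ; (inj₂ (ψ″≈ , p)) → ≤-trans p (≤-reflexive (sym ψ″≈)) }
      ≤ψ″′ : ∀ y → ψ′ y ≤ ψ″ y
      ≤ψ″′ y = case ψ-max y of λ
        { (inj₂ (ψ″≈ , _)) → ≤-reflexive (sym ψ″≈) ; (inj₁ (ψ″≈ , p)) → ≤-trans p (≤-reflexive (sym ψ″≈)) }

    isMax-max : ∀ z x xs → IsMax x (max z xs) (max z (x ∷ xs))
    isMax-max z x xs = case total x m of λ
      { (inj₁ x≤m) → inj₂ (antisym (max≤v⁺ (⊥≤max z xs) (x≤m ∷ xs≤max z xs))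
                             (max≤v⁺ (⊥≤max z (x ∷ xs)) (All.tail (xs≤max z (x ∷ xs)))) , x≤m)
      ; (inj₂ m≤x) → inj₁ (antisym (max≤v⁺ (≤-trans (⊥≤max z xs) m≤x) (≤-refl ∷ All.map (λ p → ≤-trans p m≤x) (xs≤max z xs)))
                             (All.head (xs≤max z (x ∷ xs))) , m≤x) }
      where
      m : ℝ
      m = max z xs

    -- The map `σ` gives the slope of a functional along the line `γ`: `a₁` on rows, `a₂` on
    -- columns. The head `l` stays fixed in the induction as the base value of `max`.
    maxEval-locallyMaxAffine : ∀ {γ : ℝ → ℝ²} (σ : AffineFunctional → ℝ) →
      (∀ l x t → eval l (γ t) ≈ eval l (γ x) + σ l * (t - x)) →
      ∀ {ls} → All⁺.All (IsInteger ∘ σ) ls → LocallyMaxAffine (maxEval ls ∘ γ)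
    maxEval-locallyMaxAffine {γ} σ γ-affine {l ∷ ls} (l∈ℤ ∷ ls∈ℤ) = go ls∈ℤ
      where
      go : ∀ {ls} → All (IsInteger ∘ σ) ls → LocallyMaxAffine (maxEval (l ∷ ls) ∘ γ)
      go []           = affine⇒locallyMaxAffine l∈ℤ (γ-affine l)
      go {m ∷ ms} (m∈ℤ ∷ ms∈ℤ) = max⇒locallyMaxAffine
        (λ x → isMax-max (eval l (γ x)) (eval m (γ x)) (map (λ l′ → eval l′ (γ x)) ms))
        (affine⇒locallyMaxAffine m∈ℤ (γ-affine m)) (go ms∈ℤ)

    -- The hypothesis speaks of rays because the arms of a tripod are rays; `ψ` may change with `q`.
    -- The slope of the right germ at `x` supports `φ`: to the left it is compared with a support at
    -- `x`, and beyond the radius with a support at `x + radius`, each on a sufficiently long ray.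
    integralConvex : ∀ {φ : ℝ → ℝ} → (∀ {x y} → x ≈ y → φ x ≈ φ y) →
      (∀ q → ∃ λ ψ → LocallyMaxAffine ψ × (∀ x → x ≤ q → φ x ≈ ψ x)) → IntegralConvex φ
    integralConvex {φ} φ-cong ray = record { φ-cong = φ-cong ; right = right ; left = left ; support = support }
      where
      right : ∀ x → Germ (λ t → φ (x + t)) (φ x)
      right x =
        case ray (x + 1#) of λ { (ψ , ψ-lma , φ≈ψ) →
        let open Germ (LocallyMaxAffine.right ψ-lma x) in
        case radius>0 ≤∧≤ 0<1 of λ { (ρ , 0<ρ , ρ≤radius , ρ≤1) → record
        { slope = slope ; integral = integral ; radius = ρ ; radius>0 = 0<ρ
        ; affine = λ t 0≤t t≤ρ → trans (φ≈ψ (x + t) (by (gap (≤-trans t≤ρ ρ≤1)) (solve 2 (λ x t → con (+ 1) :- t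
            := x :+ con (+ 1) :- (x :+ t)) refl x t)))
            (trans (affine t 0≤t (≤-trans t≤ρ ρ≤radius)) (+-congʳ (sym (φ≈ψ x (<⇒≤ (x<x+δ x 0<1)))))) } }}
      left : ∀ x → Germ (λ t → φ (x - t)) (φ x)
      left x =
        case ray x of λ { (ψ , ψ-lma , φ≈ψ) →
        let open Germ (LocallyMaxAffine.left ψ-lma x) in record
        { slope = slope ; integral = integral ; radius = radius ; radius>0 = radius>0
        ; affine = λ t 0≤t t≤r → trans (φ≈ψ (x - t) (by 0≤t (solve 2 (λ x t → t := x :- (x :- t)) refl x t)))
            (trans (affine t 0≤t t≤r) (+-congʳ (sym (φ≈ψ x ≤-refl)))) } }
      ray-support : ∀ q x → x ≤ q → ∃ λ a → ∀ y → y ≤ q → φ x + a * (y - x) ≤ φ y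
      ray-support q x x≤q = case ray q of λ { (ψ , ψ-lma , φ≈ψ) →
        case LocallyMaxAffine.support ψ-lma x of λ { (a , supp) →
        a , λ y y≤q → ≤-resp (+-congʳ (sym (φ≈ψ x x≤q))) (sym (φ≈ψ y y≤q)) (supp y) }}
      support : ∀ x → ∃ λ a → IsInteger a × (∀ y → φ x + a * (y - x) ≤ φ y)
      support x = slope , integral , λ y → case total y x of λ
        { (inj₁ y≤x) → case ray-support (x + radius) x (<⇒≤ (x<x+δ x radius>0)) of λ { (a , supp) →
            let a≤r : a ≤ slope
                a≤r = *-cancelʳ-≤ radius>0 (by (gap (≤-resp
                  refl (affine radius (<⇒≤ radius>0) ≤-refl) (supp (x + radius) ≤-refl)))
                  (solve 5 (λ v r ρ a x → v :+ r :* ρ :- (v :+ a :* (x :+ ρ :- x)) := r :* ρ :- a :* ρ)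
                    refl (φ x) slope radius a x))
            in by (gap (supp y (≤-trans y≤x (<⇒≤ (x<x+δ x radius>0)))) ⊞ gap a≤r ⊠ gap y≤x)
                (solve 6 (λ v w a r x y → w :- (v :+ a :* (y :- x)) :+ (r :- a) :* (x :- y)
                  := w :- (v :+ r :* (y :- x))) refl (φ x) (φ y) a slope x y) }
        ; (inj₂ x≤y) → case total y (x + radius) of λ
            { (inj₁ y≤x+ρ) → ≤-reflexive (sym (trans (φ-cong (solve 2 (λ x y → y := x :+ (y :- x))
                refl x y)) (affine (y - x) (gap x≤y) (t-x≤δ y≤x+ρ))))
            ; (inj₂ x+ρ≤y) → case ray-support y (x + radius) x+ρ≤y of λ { (a , supp) →
                let z≈ : φ (x + radius) ≈ φ x + slope * radius
                    z≈ = affine radius (<⇒≤ radius>0) ≤-refl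
                    r≤a : slope ≤ a
                    r≤a = *-cancelʳ-≤ radius>0 (by (gap (≤-resp (+-congʳ z≈) refl (supp x x≤y)))
                      (solve 5 (λ v r ρ a x → v :- (v :+ r :* ρ :+ a :* (x :- (x :+ ρ))) := a :* ρ :- r :* ρ)
                        refl (φ x) slope radius a x))
                in by (gap (≤-resp (+-congʳ z≈) refl (supp y ≤-refl)) ⊞ gap r≤a ⊠ gap x+ρ≤y)
                    (solve 7 (λ v w a r x y ρ → w :- (v :+ r :* ρ :+ a :* (y :- (x :+ ρ))) :+ (a :- r) :* (y :- (x :+ ρ)) := w :- (v :+ r :* (y :- x)))
                      refl (φ x) (φ y) a slope x y radius) } } }
        where open Germ (right x)

  -- Finitely many planes

  opaque
    integersUpTo : ∀ n → ∃ λ is → ∀ a → IsInteger a → - fromℤ (+ n) ≤ a → a ≤ fromℤ (+ n) → Any (a ≈_) is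
    integersUpTo zero = 0# ∷ [] , λ a _ -0≤a a≤0 →
      here (antisym a≤0 (≤-resp -0#≈0# refl -0≤a))
    integersUpTo (suc n) = case integersUpTo n of λ { (is , complete) →
      (1# + fromℤ (+ n)) ∷ - (1# + fromℤ (+ n)) ∷ is , λ a a∈ℤ lower upper →
      case ≤-<-connex a (fromℤ (+ n)) of λ
        { (inj₂ n<a) → here (antisym upper (integer-gap (IsInteger-fromℕ n) a∈ℤ n<a))
        ; (inj₁ a≤n) → case ≤-<-connex (- fromℤ (+ n)) a of λ
            { (inj₁ -n≤a) → there (there (complete a a∈ℤ -n≤a a≤n))
            ; (inj₂ a<-n) → there (here (antisym
                (by (gap (integer-gap a∈ℤ (IsInteger-neg (IsInteger-fromℕ n)) a<-n))
                  (solve 2 (λ a n → :- n :- (con (+ 1) :+ a) := :- (con (+ 1) :+ n) :- a) refl a (fromℤ (+ n))))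
                lower)) } } }

  module _ {f : ℝ → ℝ → ℝ} where
    opaque
      IsSupport-resp : ∀ {x y a₁ a₂ i j} → a₁ ≈ i → a₂ ≈ j → IsSupport f x y a₁ a₂ → IsSupport f x y i j
      IsSupport-resp p q supp x y = ≤-resp (+-congˡ (+-cong (*-congʳ p) (*-congʳ q))) refl (supp x y)

      -- Two supports with the same slopes are equal, so one support per pair of
      -- slopes is enough.
      supportsWithSlopes : ∀ (slopes : List ℝ²) → ∃ λ ls → All Transintegral ls ×
        All (λ l → ∀ x y → eval l (x , y) ≤ f x y) ls ×
        (∀ {x y a₁ a₂} → IsInteger a₁ → IsInteger a₂ → IsSupport f x y a₁ a₂ →
          Any (λ (i , j) → a₁ ≈ i × a₂ ≈ j) slopes → Any (λ l → f x y ≤ eval l (x , y)) ls)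
      supportsWithSlopes [] = [] , [] , [] , λ _ _ _ ()
      supportsWithSlopes ((i , j) ∷ slopes)
        with supportsWithSlopes slopes | em {IsInteger i × IsInteger j × ∃₂ λ x y → IsSupport f x y i j}
      ... | ls , ls∈ℤ , ls≤f , complete | no ¬p = ls , ls∈ℤ , ls≤f ,
        λ { a₁∈ℤ a₂∈ℤ supp (here (a₁≈i , a₂≈j)) → ⊥-elim (¬p
              (IsInteger-resp a₁≈i a₁∈ℤ , IsInteger-resp a₂≈j a₂∈ℤ , _ , _ , IsSupport-resp a₁≈i a₂≈j supp))
          ; a₁∈ℤ a₂∈ℤ supp (there p) → complete a₁∈ℤ a₂∈ℤ supp p }
      ... | ls , ls∈ℤ , ls≤f , complete | yes (i∈ℤ , j∈ℤ , x₁ , y₁ , supp₁) =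
        record { a₁ = i ; a₂ = j ; b = f x₁ y₁ - (i * x₁ + j * y₁) } ∷ ls ,
        (i∈ℤ , j∈ℤ) ∷ ls∈ℤ ,
        (λ x y → ≤-resp (solve 7 (λ v i j x y x₁ y₁ → v :+ (i :* (x :- x₁) :+ j :* (y :- y₁))
            := i :* x :+ j :* y :+ (v :- (i :* x₁ :+ j :* y₁))) refl (f x₁ y₁) i j x y x₁ y₁)
              refl (supp₁ x y)) ∷ ls≤f ,
        λ { {x} {y} a₁∈ℤ a₂∈ℤ supp (here (a₁≈i , a₂≈j)) → here (by (gap (IsSupport-resp a₁≈i a₂≈j supp x₁ y₁))
              (solve 8 (λ v w i j x y x₁ y₁ → w :- (v :+ (i :* (x₁ :- x) :+ j :* (y₁ :- y)))
                := i :* x :+ j :* y :+ (w :- (i :* x₁ :+ j :* y₁)) :- v) refl (f x y) (f x₁ y₁) i j x y x₁ y₁))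
          ; a₁∈ℤ a₂∈ℤ supp (there p) → there (complete a₁∈ℤ a₂∈ℤ supp p) }

      -- Otherwise, at `t = (m + 1) / (σ - B)`, the surplus `(σ - B) * t` reaches `m + 1`, more than
      -- the constants `C + c - v` allow.
      slope-bound : ∀ {C B v c σ} → (∀ t → 0# ≤ t → v + (σ * t - c) ≤ C + B * t) → σ ≤ B
      slope-bound {C} {B} {v} {c} {σ} below = ≮⇒≥ λ B<σ →
        case reciprocal (gap< B<σ) of λ { (i , 0<i , [σ-B]i≈1) →
        case upperBound (C + c - v) 0# of λ { (m , D≤m , 0≤m) →
        by< (0<1 ⊞< (gap D≤m ⊞ gap≈ (trans (sym (trans (*-congˡ [σ-B]i≈1)
              (*-identityʳ _))) (solve 3 (λ m e i → m :* (e :* i) := e :* (m :* i)) refl (m + 1#) (σ - B) i))))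
          (solve 7 (λ m C c v σ B t → con (+ 1) :+ (m :- (C :+ c :- v) :+ ((σ :- B) :* t :- (m :+ con (+ 1))))
            := v :+ (σ :* t :- c) :- (C :+ B :* t)) refl m C c v σ B ((m + 1#) * i))
          (below ((m + 1#) * i) ((0≤m ⊞ 0≤1) ⊠ <⇒≤ 0<i)) }}

      linear-bound : ∀ d₁ d₂ l ls → ∃₂ λ C B →
        All (λ l → ∀ t → 0# ≤ t → eval l (t * d₁ , t * d₂) ≤ C + B * t) (l ∷ ls)
      linear-bound d₁ d₂ l [] = b , a₁ l * d₁ + a₂ l * d₂ ,
        (λ t 0≤t → ≤-reflexive (solve 6 (λ a₁ a₂ b d₁ d₂ t → a₁ :* (t :* d₁) :+ a₂ :* (t :* d₂) :+ b
          := b :+ (a₁ :* d₁ :+ a₂ :* d₂) :* t) refl (a₁ l) (a₂ l) b d₁ d₂ t)) ∷ []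
        where open AffineFunctional l using (b)
      linear-bound d₁ d₂ l (l′ ∷ ls) =
        case linear-bound d₁ d₂ l [] of λ { (C₁ , B₁ , l≤ ∷ []) →
        case linear-bound d₁ d₂ l′ ls of λ { (C₂ , B₂ , ls≤) →
        case upperBound C₁ C₂ of λ { (C , C₁≤C , C₂≤C) →
        case upperBound B₁ B₂ of λ { (B , B₁≤B , B₂≤B) →
        C , B , (λ t 0≤t → ≤-trans (l≤ t 0≤t) (mono C₁≤C B₁≤B 0≤t)) ∷
          All.map (λ p t 0≤t → ≤-trans (p t 0≤t) (mono C₂≤C B₂≤B 0≤t)) ls≤ }}}}
        where
        mono : ∀ {C C′ B B′ t} → C ≤ C′ → B ≤ B′ → 0# ≤ t → C + B * t ≤ C′ + B′ * t
        mono {C} {C′} {B} {B′} {t} p q 0≤t = by (gap p ⊞ gap q ⊠ 0≤t)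
          (solve 5 (λ C C′ B B′ t → C′ :- C :+ (B′ :- B) :* t := C′ :+ B′ :* t :- (C :+ B :* t))
            refl C C′ B B′ t)

      -- A supporting plane stays below `f`, which grows at most linearly along the ray. Its slope
      -- in that direction is thus at most the growth rate, wherever the plane touches.
      support-slope-bound : ∀ d₁ d₂ {ls} → (∀ t → 0# ≤ t → f (t * d₁) (t * d₂) ≈ maxEval ls (t * d₁ , t * d₂)) →
        ∃ λ B → ∀ {x y a₁ a₂} → IsSupport f x y a₁ a₂ → a₁ * d₁ + a₂ * d₂ ≤ B
      support-slope-bound d₁ d₂ {l ∷ ls} f≈max = case linear-bound d₁ d₂ l ls of λ { (C , B , l≤ ∷ ls≤) →
        B , λ {x} {y} {a₁} {a₂} supp → slope-bound {C} {B} {f x y} {a₁ * x + a₂ * y} λ t 0≤t →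
          ≤-resp (solve 8 (λ v a₁ a₂ x y d₁ d₂ t → v :+ (a₁ :* (t :* d₁ :- x) :+ a₂ :* (t :* d₂ :- y))
              := v :+ ((a₁ :* d₁ :+ a₂ :* d₂) :* t :- (a₁ :* x :+ a₂ :* y)))
                refl (f x y) a₁ a₂ x y d₁ d₂ t) refl
            (≤-trans (supp (t * d₁) (t * d₂)) (≤-trans (≤-reflexive (f≈max t 0≤t))
              (max≤v⁺ (l≤ t 0≤t) (All.map⁺ (All.map (λ p → p t 0≤t) ls≤))))) }

  -- From lines and tripods to the plane

  module _ (f : Function²) where
    open Func f using (to) renaming (cong to to-cong)

    private
      F : ℝ → ℝ → ℝ
      F x y = to (x , y)

    BoundedSupports : Set
    BoundedSupports = ∃ λ M → ∀ {x y a₁ a₂} → IsSupport F x y a₁ a₂ → (a₁ ≤ M × - a₁ ≤ M) × (a₂ ≤ M × - a₂ ≤ M)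

    opaque
      polyhedral : SeparatelyIntegralConvex F → BoundedSupports → TransintegralPolyhedral U (restrict U f)
      polyhedral F-sep (M , bounded) =
        case archimedean M of λ { (n , M≤n) →
        case integersUpTo n of λ { (is , complete) →
        case supportsWithSlopes {F} (cartesianProduct is is) of λ { (ls , ls∈ℤ , ls≤F , covers) →
        maximum ls ls∈ℤ ls≤F λ x y →
          case integral-support F-sep x y of λ { (a₁ , a₂ , a₁∈ℤ , a₂∈ℤ , supp) →
          case bounded supp of λ { ((a₁≤M , -a₁≤M) , (a₂≤M , -a₂≤M)) →
          covers a₁∈ℤ a₂∈ℤ supp (Any.cartesianProduct⁺
            (complete a₁ a₁∈ℤ (-≤ (≤-trans -a₁≤M M≤n)) (≤-trans a₁≤M M≤n))
            (complete a₂ a₂∈ℤ (-≤ (≤-trans -a₂≤M M≤n)) (≤-trans a₂≤M M≤n))) }} }}}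
        where
        -≤ : ∀ {a n} → - a ≤ n → - n ≤ a
        -≤ {a} {n} p = by (gap p) (solve 2 (λ a n → n :- :- a := a :- :- n) refl a n)
        maximum : ∀ ls → All Transintegral ls → All (λ l → ∀ x y → eval l (x , y) ≤ F x y) ls →
          (∀ x y → Any (λ l → F x y ≤ eval l (x , y)) ls) → TransintegralPolyhedral U (restrict U f)
        -- The list cannot be empty, since some plane attains `f` at the origin.
        maximum [] _ _ attained = case attained 0# 0# of λ ()
        maximum (l ∷ ls) (l∈ℤ ∷ ls∈ℤ) (l≤F ∷ ls≤F) attained = l ∷ ls , l∈ℤ ∷ ls∈ℤ , λ (x , y) _ →
          antisym
            (v≤max⁺ _ _ (case attained x y of λ { (here p) → inj₁ p ; (there p) → inj₂ (Any.map⁺ p) }))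
            (max≤v⁺ (l≤F x y) (All.map⁺ (All.map (λ p → p x y) ls≤F)))

      separatelyIntegralConvex :
        (∀ y q → ∃ λ ls → All⁺.All Transintegral ls × (∀ x → x ≤ q → F x y ≈ maxEval ls (x , y))) →
        (∀ x q → ∃ λ ls → All⁺.All Transintegral ls × (∀ y → y ≤ q → F x y ≈ maxEval ls (x , y))) →
        SeparatelyIntegralConvex F
      separatelyIntegralConvex rows cols = record
        { row = λ y → integralConvex (λ x≈ → to-cong (x≈ , refl)) λ q →
            case rows y q of λ { (ls , l∈ℤ ∷ ls∈ℤ , F≈) → maxEval ls ∘ (_, y) ,
              maxEval-locallyMaxAffine a₁ (λ l x t → solve 6 (λ a₁ a₂ b x t y → a₁ :* t :+ a₂ :* y :+ b
                  := a₁ :* x :+ a₂ :* y :+ b :+ a₁ :* (t :- x)) refl (a₁ l) (a₂ l) (AffineFunctional.b l) x t y)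
                (proj₁ l∈ℤ ∷ All.map proj₁ ls∈ℤ) , F≈ }
        ; col = λ x → integralConvex (λ y≈ → to-cong (refl , y≈)) λ q →
            case cols x q of λ { (ls , l∈ℤ ∷ ls∈ℤ , F≈) → maxEval ls ∘ (x ,_) ,
              maxEval-locallyMaxAffine a₂ (λ l y t → solve 6 (λ a₁ a₂ b x t y → a₁ :* x :+ a₂ :* t :+ b
                  := a₁ :* x :+ a₂ :* y :+ b :+ a₂ :* (t :- y)) refl (a₁ l) (a₂ l) (AffineFunctional.b l) x t y)
                (proj₂ l∈ℤ ∷ All.map proj₂ ls∈ℤ) , F≈ }
        }

      lines⇒polyhedral :
        (∀ t → TransintegralPolyhedral (horizontalLine t) (restrict (horizontalLine t) f)) →
        (∀ t → TransintegralPolyhedral (verticalLine t) (restrict (verticalLine t) f)) →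
        TransintegralPolyhedral U (restrict U f)
      lines⇒polyhedral horizontal vertical = polyhedral
        (separatelyIntegralConvex
          (λ y q → let ls , ls∈ℤ , f≈ = horizontal y in ls , ls∈ℤ , λ x _ → f≈ (x , y) refl)
          (λ x q → let ls , ls∈ℤ , f≈ = vertical x in ls , ls∈ℤ , λ y _ → f≈ (x , y) refl))
        (case horizontal 0# of λ { (ls , _ , f≈) →
         case vertical 0# of λ { (ls′ , _ , f≈′) →
         case support-slope-bound {F} 1# 0# {ls} (λ t _ → f≈ _ (zeroʳ t)) of λ { (B₁ , p₁) →
         case support-slope-bound {F} (- 1#) 0# {ls} (λ t _ → f≈ _ (zeroʳ t)) of λ { (B₂ , p₂) →
         case support-slope-bound {F} 0# 1# {ls′} (λ t _ → f≈′ _ (zeroʳ t)) of λ { (B₃ , p₃) →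
         case support-slope-bound {F} 0# (- 1#) {ls′} (λ t _ → f≈′ _ (zeroʳ t)) of λ { (B₄ , p₄) →
         case upperBound B₁ B₂ of λ { (M₁ , B₁≤ , B₂≤) →
         case upperBound B₃ B₄ of λ { (M₂ , B₃≤ , B₄≤) →
         case upperBound M₁ M₂ of λ { (M , M₁≤ , M₂≤) →
         M , λ {x} {y} {a₁} {a₂} supp →
           (≤-resp (solve 2 (λ a₁ a₂ → a₁ :* con (+ 1) :+ a₂ :* con (+ 0) := a₁) refl a₁ a₂) refl
              (≤-trans (p₁ supp) (≤-trans B₁≤ M₁≤)) ,
            ≤-resp (solve 2 (λ a₁ a₂ → a₁ :* :- con (+ 1) :+ a₂ :* con (+ 0) := :- a₁) refl a₁ a₂) refl
              (≤-trans (p₂ supp) (≤-trans B₂≤ M₁≤))) ,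
           (≤-resp (solve 2 (λ a₁ a₂ → a₁ :* con (+ 0) :+ a₂ :* con (+ 1) := a₂) refl a₁ a₂) refl
              (≤-trans (p₃ supp) (≤-trans B₃≤ M₂≤)) ,
            ≤-resp (solve 2 (λ a₁ a₂ → a₁ :* con (+ 0) :+ a₂ :* :- con (+ 1) := :- a₂) refl a₁ a₂) refl
              (≤-trans (p₄ supp) (≤-trans B₄≤ M₂≤))) }}}}}}}}})

      -- The part of a row up to `q` is an arm of the tripod at `(q , y)`, and likewise for columns.
      -- The arms point along `(-1 , 0)`, `(0 , -1)` and `(1 , 1)`, which positively span the plane:
      -- bounds on `- a₁`, `- a₂` and `a₁ + a₂` yield `a₁ ≤ B₃ + B₂` and `a₂ ≤ B₃ + B₁`.
      tripods⇒polyhedral :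
        (∀ q → TransintegralPolyhedral (translate q L) (restrict (translate q L) f)) →
        TransintegralPolyhedral U (restrict U f)
      tripods⇒polyhedral tripod = polyhedral
        (separatelyIntegralConvex
          (λ y q → let ls , ls∈ℤ , f≈ = tripod (q , y) in ls , ls∈ℤ , λ x x≤q →
            f≈ (x , y) (inj₂ (inj₁ (≤0 x≤q , -‿inverseʳ y))))
          (λ x q → let ls , ls∈ℤ , f≈ = tripod (x , q) in ls , ls∈ℤ , λ y y≤q →
            f≈ (x , y) (inj₁ (-‿inverseʳ x , ≤0 y≤q))))
        (case tripod (0# , 0#) of λ { (ls , _ , f≈) →
         case support-slope-bound {F} (- 1#) 0# {ls} (λ t 0≤t → f≈ _ (inj₂ (inj₁ (t*-1≤0 0≤t , t*0≈0 t)))) of λ { (B₁ , p₁) →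
         case support-slope-bound {F} 0# (- 1#) {ls} (λ t 0≤t → f≈ _ (inj₁ (t*0≈0 t , t*-1≤0 0≤t))) of λ { (B₂ , p₂) →
         case support-slope-bound {F} 1# 1# {ls} (λ t 0≤t → f≈ _ (inj₂ (inj₂ (refl , 0≤t*1 0≤t)))) of λ { (B₃ , p₃) →
         case upperBound B₁ B₂ of λ { (M₁ , B₁≤ , B₂≤) →
         case upperBound (B₃ + B₂) (B₃ + B₁) of λ { (M₂ , B₃₂≤ , B₃₁≤) →
         case upperBound M₁ M₂ of λ { (M , M₁≤ , M₂≤) →
         M , λ {x} {y} {a₁} {a₂} supp →
           (≤-trans (by (gap (p₃ supp) ⊞ gap (p₂ supp)) (solve 4 (λ a₁ a₂ B₂ B₃ →
                B₃ :- (a₁ :* con (+ 1) :+ a₂ :* con (+ 1)) :+ (B₂ :- (a₁ :* con (+ 0) :+ a₂ :* :- con (+ 1)))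
                  := B₃ :+ B₂ :- a₁)
                refl a₁ a₂ B₂ B₃)) (≤-trans B₃₂≤ M₂≤) ,
            ≤-resp (solve 2 (λ a₁ a₂ → a₁ :* :- con (+ 1) :+ a₂ :* con (+ 0) := :- a₁) refl a₁ a₂) refl
              (≤-trans (p₁ supp) (≤-trans B₁≤ M₁≤))) ,
           (≤-trans (by (gap (p₃ supp) ⊞ gap (p₁ supp)) (solve 4 (λ a₁ a₂ B₁ B₃ →
                B₃ :- (a₁ :* con (+ 1) :+ a₂ :* con (+ 1)) :+ (B₁ :- (a₁ :* :- con (+ 1) :+ a₂ :* con (+ 0)))
                  := B₃ :+ B₁ :- a₂)
                refl a₁ a₂ B₁ B₃)) (≤-trans B₃₁≤ M₂≤) ,
            ≤-resp (solve 2 (λ a₁ a₂ → a₁ :* con (+ 0) :+ a₂ :* :- con (+ 1) := :- a₂) refl a₁ a₂) refl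
              (≤-trans (p₂ supp) (≤-trans B₂≤ M₁≤))) }}}}}}})
        where
        ≤0 : ∀ {x q} → x ≤ q → x + - q ≤ 0#
        ≤0 {x} {q} p = by (gap p) (solve 2 (λ x q → q :- x := con (+ 0) :- (x :- q)) refl x q)
        t*0≈0 : ∀ t → t * 0# + - 0# ≈ 0#
        t*0≈0 = solve 1 (λ t → t :* con (+ 0) :- con (+ 0) := con (+ 0)) refl
        t*-1≤0 : ∀ {t} → 0# ≤ t → t * - 1# + - 0# ≤ 0#
        t*-1≤0 {t} p = by p (solve 1 (λ t → t := con (+ 0) :- (t :* :- con (+ 1) :- con (+ 0))) refl t)
        0≤t*1 : ∀ {t} → 0# ≤ t → 0# ≤ t * 1# + - 0#
        0≤t*1 {t} p = by p (solve 1 (λ t → t := t :* con (+ 1) :- con (+ 0) :- con (+ 0)) refl t)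

theorem9p1 : ExcludedMiddle 0ℓ → (R : CompleteOrderedField) →
    let open Plane R
        open CompleteOrderedField R using () renaming (Carrier to ℝ) in
    (f : Function²) →
    let a = TransintegralPolyhedral U (restrict U f)
        b = ((t : ℝ) → TransintegralPolyhedral (horizontalLine t) (restrict (horizontalLine t) f)) ×
            ((t : ℝ) → TransintegralPolyhedral (verticalLine t) (restrict (verticalLine t) f))
        c = (q : ℝ²) → TransintegralPolyhedral (translate q L) (restrict (translate q L) f)
    in (a ⇔ b) × (a ⇔ c)
theorem9p1 em R f =
  mk⇔ (λ a → (λ t → restricted a) , λ t → restricted a)
      (λ (horizontal , vertical) → lines⇒polyhedral em R f horizontal vertical) ,
  mk⇔ (λ a q → restricted a) (tripods⇒polyhedral em R f)
  where
  open Plane R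
  restricted : ∀ {T} → TransintegralPolyhedral U (restrict U f) → TransintegralPolyhedral T (restrict T f)
  restricted (ls , ls∈ℤ , f≈max) = ls , ls∈ℤ , λ p _ → f≈max p tt
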